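{- Let $r>3$ be an integer and $n$ a positive integer. If the graph of an $\{r,r+1\}$-leaper on a $(2r+1)\times n$ board has a Hamiltonian circuit, then $n\ge r^2+5r+2$ if $r$ is odd, and $n\ge r^2+6r+4$ if $r$ is even.
   Context: For positive integers $r,s$, the graph of an $\{r,s\}$-leaper on an $m\times n$ board has vertex set $\{(x,y): 0\le x<m,\ 0\le y<n\}$ (integers), with an edge between $(x,y)$ and $(x',y')$ whenever $(x'-x,y'-y)\in\{(\pm r,\pm s),(\pm s,\pm r)\}$. Here $m=2r+1$. A Hamiltonian circuit is a cycle passing through every vertex exactly once. -}

module Defs where

open import Data.Nat using (ℕ; zero; suc; _*_; _+_; ∣_-_∣; _≟_; _≤_)
open import Relation.Nullary using (yes; no)
open import Data.Fin using (Fin; toℕ; zero; suc; fromℕ; inject₁; lower₁)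
open import Data.Product using (_×_; _,_)
open import Data.Sum using (_⊎_)
open import Relation.Binary.PropositionalEquality using (_≡_)
open import Function.Definitions using (Injective; Surjective)

Square : ℕ → ℕ → Set
Square m n = Fin m × Fin n

LeaperAdj : (r s : ℕ) {m n : ℕ} → Square m n → Square m n → Set
LeaperAdj r s (x , y) (x' , y') =
  (∣ toℕ x - toℕ x' ∣ ≡ r × ∣ toℕ y - toℕ y' ∣ ≡ s)
  ⊎ (∣ toℕ x - toℕ x' ∣ ≡ s × ∣ toℕ y - toℕ y' ∣ ≡ r)

csuc : {k : ℕ} → Fin k → Fin k
csuc {suc k} i with k ≟ toℕ i
... | yes _ = zero
... | no ne = suc (lower₁ i ne)

-- A Hamiltonian circuit of a graph with vertex type V and adjacency E,
-- where the vertex set has N elements: a cyclic enumeration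
-- c 0, c 1, …, c (N-1) of all vertices, each exactly once (c is a
-- bijection Fin N → V), with c i adjacent to c (i+1 mod N).
-- (A cycle needs at least 3 vertices.)
record HamiltonianCircuit (N : ℕ) (V : Set) (E : V → V → Set) : Set where
  field
    atLeast3 : 3 ≤ N
    c        : Fin N → V
    inj      : Injective _≡_ _≡_ c
    surj     : Surjective _≡_ _≡_ c
    adj      : ∀ i → E (c i) (c (csuc i))

LeaperHamiltonian : (r s m n : ℕ) → Set
LeaperHamiltonian r s m n =
  HamiltonianCircuit (m * n) (Square m n) (LeaperAdj r s {m} {n})

{-# OPTIONS --safe #-}
module Submission where

-- Every edge of the circuit joins heights that differ by r or r + 1.  Let G x be the
-- number of edges whose lower end is below height x.  Counting edge ends below height
-- x + r + 1 gives G (x + r + 1) + G x + b x = 2 (2r + 1) (x + r + 1), where b x ≤ 2r counts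
-- the edges of vertical extent r that start at height x; likewise at distance r, with an
-- error of at most 2r + 2.  Hence near either end of the board the heights fall into
-- alternating bands of about r rows from which all edges go up, or all go down.  The
-- bands seen from the bottom are compatible with those seen from the top only if
-- n > 2r² + r, which exceeds the required bound as soon as r ≥ 5.
--
-- For r = 4 the heights 37 ≤ n ≤ 43 remain.  Odd n is excluded by the chessboard colouring
-- and n = 42 by G alone; for n = 38 and n = 40 the equations for G leave so few choices
-- that the circuit would contain a closed 18-cycle.

open import Defs
open import Data.Bool.Base using (Bool; true; false; not; if_then_else_)
open import Data.Empty using (⊥)
open import Data.Fin as Fin using (Fin; toℕ; fromℕ; fromℕ<; inject₁; lower₁; #_)
import Data.Fin.Properties as Fin
open import Data.Fin.Permutation using (Permutation; permutation)
open import Data.List.Base using ([]; _∷_)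
open import Data.Nat
open import Data.Nat.Divisibility using (_∣_; ∣⇒≤; ∣m+n∣m⇒∣n; m∣m*n)
open import Data.Nat.DivMod using (_/_; _%_; m≡m%n+[m/n]*n; m%n<n; %-distribˡ-+; [m+kn]%n≡m%n; m*n%n≡0)
open import Data.Nat.Properties
open import Data.Nat.Tactic.RingSolver using (solve-∀; solve)
open import Data.Product using (_×_; _,_; ∃; ∃₂; proj₁; proj₂)
open import Data.Product.Properties using (≡-dec)
open import Data.Sum using (_⊎_; inj₁; inj₂; swap)
open import Data.Vec.Base as Vec using (Vec; lookup)
open import Function using (_∘_)
open import Relation.Binary.Definitions using (tri<; tri≈; tri>)
open import Relation.Binary.PropositionalEquality
open import Relation.Nullary
open import Relation.Nullary.Decidable
open import Algebra.Properties.CommutativeMonoid.Sum +-0-commutativeMonoid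
  using (sum; sum-cong-≗; ∑-distrib-+; ∑-comm; sum-permute)

-- Horizontal positions enter the general bound only through the capacities `a ≤ 2 r + 2` and
-- `b ≤ 2 r`, whose sum is exactly the number `2 (2 r + 1)` of edge ends in a row. This is why a
-- band loses only one row of width each time it is reflected. Two regimes of `n` alternate. If
-- `(2 j + 1) (r + 1) ≤ n ≤ (2 j + 3) r`, the chain of steps `r + 1` and the chain of steps `r`
-- reach the top after equally many steps, and comparing the two estimates of `G` suffices. In the
-- gaps `(2 j + 3) r < n < (2 j + 3) (r + 1)` no common number of steps serves both, and the bands
-- take over. Their directions conflict as long as `j + 1 < r`, hence for every gap height up to
-- `(2 r + 1) r`; this is the origin of `2 r² + r`.

infixl 6 _⊕_
_⊕_ : ∀ {a b c d} → a ≤ b → c ≤ d → a + c ≤ b + d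
_⊕_ = +-mono-≤

-- Farkas-style elimination: an inequality follows from a sum of hypotheses
-- A ≤ B once l - r is identified with A - B.
farkas : ∀ {A B} l r → A ≤ B → l + B ≡ r + A → l ≤ r
farkas {A} {B} l r A≤B eq =
  +-cancelʳ-≤ B l r (≤-trans (≤-reflexive eq) (+-monoʳ-≤ r A≤B))

infixl 6 _⊞_
_⊞_ : ∀ {a b c d : ℕ} → a ≡ b → c ≡ d → a + c ≡ b + d
_⊞_ = cong₂ _+_

balance : ∀ {A B} l r → A ≡ B → l + B ≡ r + A → l ≡ r
balance {A} l r refl eq = +-cancelʳ-≡ A l r eq

≡⇒≥ : ∀ {x y : ℕ} → x ≡ y → y ≤ x
≡⇒≥ eq = ≤-reflexive (sym eq)

-- a h and b h count the circuit edges with lower end at height h and vertical extent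
-- r + 1 and r respectively; 2 * (2 * r + 1) is the number of edge ends in a row.
record LevelCounts (r n : ℕ) : Set where
  field
    G a b     : ℕ → ℕ
    G-bottom  : ∀ {x} → x ≤ r → x ≤ n → G x ≡ 2 * (2 * r + 1) * x
    G-suc     : ∀ x → G (suc x) ≡ G x + (a x + b x)
    G-reflect : ∀ x → x + suc r ≤ n → G (x + suc r) + G x + b x ≡ 2 * (2 * r + 1) * (x + suc r)
    a≤        : ∀ x → a x ≤ 2 * r + 2
    b≤        : ∀ x → b x ≤ 2 * r
    G-top     : ∀ {x} → n ≤ x + r → G x ≡ (2 * r + 1) * n

-- Estimates of `G` along steps of `r + 1` and of `r`

module _ {r n : ℕ} (L : LevelCounts r n) where
  open LevelCounts L

  -- `G-suc` absorbs the edges that start at `x`: the reflection distance drops from `r + 1` to `r`,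
  -- and the error `b x` on the left becomes `a x` on the right.
  G-reflect′ : ∀ x → x + suc r ≤ n → G (x + suc r) + G (suc x) ≡ 2 * (2 * r + 1) * (x + suc r) + a x
  G-reflect′ x h = aux (G (x + suc r)) (G x) (G (suc x)) (a x) (b x) _ (G-reflect x h) (G-suc x)
    where
    aux : ∀ g″ g g′ α β d → g″ + g + β ≡ d → g′ ≡ g + (α + β) → g″ + g′ ≡ d + α
    aux g″ g g′ α β _ refl refl = solve (g″ ∷ g ∷ α ∷ β ∷ [])

  -- Subtracting two consecutive instances of `G-reflect` cancels the middle value of `G`; only the
  -- later `b` can lower the increment.
  lower-step : ∀ x → x + suc r + suc r ≤ n →
               G x + 2 * (2 * r + 1) * suc r ≤ G (x + suc r + suc r) + 2 * r
  lower-step x h = aux (G x) (G (x + suc r)) (G (x + suc r + suc r)) (b x) (b (x + suc r)) r x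
      (G-reflect x (≤-trans (m≤m+n _ _) h)) (G-reflect (x + suc r) h) (b≤ (x + suc r))
    where
    aux : ∀ g g′ g″ β β′ r x → g′ + g + β ≡ 2 * (2 * r + 1) * (x + suc r) →
          g″ + g′ + β′ ≡ 2 * (2 * r + 1) * (x + suc r + suc r) → β′ ≤ 2 * r →
          g + 2 * (2 * r + 1) * suc r ≤ g″ + 2 * r
    aux g g′ g″ β β′ r x e e′ h = farkas _ _ (≤-reflexive e ⊕ ≡⇒≥ e′ ⊕ h ⊕ z≤n {β})
      (solve (g ∷ g′ ∷ g″ ∷ β ∷ β′ ∷ r ∷ x ∷ []))

  -- By `G-bottom` the starting offset `c` cancels, so the bound depends on `j` alone and `c` stays
  -- free for placing the end of the chain. The same holds in `upper`.
  lower : ∀ {c} → c ≤ r → ∀ j → c + suc r + j * (suc r + suc r) ≤ n →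
          2 * (2 * r + 1) * suc r * suc j ≤ G (c + suc r + j * (suc r + suc r)) + 2 * r * suc j
  lower {c} c≤r zero h rewrite +-identityʳ (c + suc r) =
    aux (G (c + suc r)) (G c) (b c) r c (G-reflect c h) (G-bottom c≤r (≤-trans (m≤m+n _ _) h)) (b≤ c)
    where
    aux : ∀ g′ g β r c → g′ + g + β ≡ 2 * (2 * r + 1) * (c + suc r) → g ≡ 2 * (2 * r + 1) * c → β ≤ 2 * r →
          2 * (2 * r + 1) * suc r * 1 ≤ g′ + 2 * r * 1
    aux g′ g β r c e e′ h = farkas _ _ (≡⇒≥ e ⊕ ≤-reflexive e′ ⊕ h) (solve (g′ ∷ g ∷ β ∷ r ∷ c ∷ []))
  lower {c} c≤r (suc j) h =
    aux (G x) (G (c + suc r + suc j * (suc r + suc r))) r j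
      (lower c≤r j (≤-trans (≤-trans (m≤m+n _ _) (m≤m+n _ _)) h′))
      (subst (λ y → G x + 2 * (2 * r + 1) * suc r ≤ G y + 2 * r) (sym eq) (lower-step x h′))
    where
    x = c + suc r + j * (suc r + suc r)
    eq : c + suc r + suc j * (suc r + suc r) ≡ c + suc r + j * (suc r + suc r) + suc r + suc r
    eq = solve (c ∷ r ∷ j ∷ [])
    h′ : x + suc r + suc r ≤ n
    h′ = subst (_≤ n) eq h
    aux : ∀ g g′ r j → 2 * (2 * r + 1) * suc r * suc j ≤ g + 2 * r * suc j →
          g + 2 * (2 * r + 1) * suc r ≤ g′ + 2 * r →
          2 * (2 * r + 1) * suc r * suc (suc j) ≤ g′ + 2 * r * suc (suc j)
    aux g g′ r j h h′ = farkas _ _ (h ⊕ h′) (solve (g ∷ g′ ∷ r ∷ j ∷ []))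

  upper-step : ∀ x → x + r + suc r ≤ n →
               G (x + r + suc r) ≤ G (suc x) + 2 * (2 * r + 1) * r + (2 * r + 2)
  upper-step x h =
    aux (G (suc x)) (G (x + suc r)) (G (x + r + suc r)) (a x) (a (x + r)) r x
      (G-reflect′ x (≤-trans (+-monoˡ-≤ (suc r) (m≤m+n x r)) h))
      (subst (λ y → G (x + r + suc r) + G y ≡ 2 * (2 * r + 1) * (x + r + suc r) + a (x + r))
        (sym (+-suc x r)) (G-reflect′ (x + r) h))
      (a≤ (x + r))
    where
    aux : ∀ g g′ g″ α α′ r x → g′ + g ≡ 2 * (2 * r + 1) * (x + suc r) + α →
          g″ + g′ ≡ 2 * (2 * r + 1) * (x + r + suc r) + α′ → α′ ≤ 2 * r + 2 →
          g″ ≤ g + 2 * (2 * r + 1) * r + (2 * r + 2)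
    aux g g′ g″ α α′ r x e e′ h = farkas _ _ (≡⇒≥ e ⊕ ≤-reflexive e′ ⊕ h ⊕ z≤n {α})
      (solve (g ∷ g′ ∷ g″ ∷ α ∷ α′ ∷ r ∷ x ∷ []))

  upper : ∀ {c} → c < r → ∀ j → suc c + r + j * (r + r) ≤ n →
          G (suc c + r + j * (r + r)) ≤ (2 * (2 * r + 1) * r + (2 * r + 2)) * suc j
  upper {c} c<r zero h rewrite +-identityʳ (c + r) | sym (+-suc c r) =
    aux (G (c + suc r)) (G (suc c)) (a c) r c (G-reflect′ c h) (G-bottom c<r (≤-trans c<r (≤-trans (n≤1+n r) (≤-trans (m≤n+m (suc r) c) h)))) (a≤ c)
    where
    aux : ∀ g′ g α r c → g′ + g ≡ 2 * (2 * r + 1) * (c + suc r) + α → g ≡ 2 * (2 * r + 1) * suc c → α ≤ 2 * r + 2 →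
          g′ ≤ (2 * (2 * r + 1) * r + (2 * r + 2)) * 1
    aux g′ g α r c e e′ h = farkas _ _ (≤-reflexive e ⊕ ≡⇒≥ e′ ⊕ h) (solve (g ∷ g′ ∷ α ∷ r ∷ c ∷ []))
  upper {c} c<r (suc j) h =
    aux (G (suc x)) (G (suc c + r + suc j * (r + r))) r j
      (upper c<r j (≤-trans (s≤s (≤-trans (m≤m+n x r) (m≤m+n (x + r) r))) (≤-trans (≤-reflexive (sym (+-suc (x + r) r))) h′)))
      (subst (λ y → G y ≤ G (suc x) + 2 * (2 * r + 1) * r + (2 * r + 2)) (sym eq) (upper-step x h′))
    where
    x = c + r + j * (r + r)
    eq : suc c + r + suc j * (r + r) ≡ c + r + j * (r + r) + r + suc r
    eq = solve (c ∷ r ∷ j ∷ [])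
    h′ : x + r + suc r ≤ n
    h′ = subst (_≤ n) eq h
    aux : ∀ g g′ r j → g ≤ (2 * (2 * r + 1) * r + (2 * r + 2)) * suc j →
          g′ ≤ g + 2 * (2 * r + 1) * r + (2 * r + 2) →
          g′ ≤ (2 * (2 * r + 1) * r + (2 * r + 2)) * suc (suc j)
    aux g g′ r j h h′ = farkas _ _ (h ⊕ h′) (solve (g ∷ g′ ∷ r ∷ j ∷ []))

-- Shifts the endpoint `k` of a chain into the zone from `n - r` to `n`, where `G-top` gives the
-- value of `G`.
offset : ∀ k t r n → k ≤ n → n ≤ t + k + r → ∃ λ c → c ≤ t × c + k ≤ n × n ≤ c + k + r
offset k t r n k≤n n≤ with ≤-total n (k + r)
... | inj₁ n≤k+r = 0 , z≤n , k≤n , n≤k+r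
... | inj₂ k+r≤n = n ∸ (k + r)
                 , +-cancelʳ-≤ (k + r) _ t (≤-trans (≤-reflexive c+) (≤-trans n≤ (≤-reflexive (+-assoc t k r))))
                 , ≤-trans (m≤m+n _ r) (≤-reflexive (trans (+-assoc _ k r) c+))
                 , ≤-reflexive (sym (trans (+-assoc _ k r) c+))
  where
  c+ : n ∸ (k + r) + (k + r) ≡ n
  c+ = m∸n+n≡m k+r≤n

-- The two estimates of G near the top, (2 r + 1) n, coincide exactly; equality then
-- forces 2 r + 1 to divide j + 1.
even-window : ∀ {r n} → LevelCounts (suc r) n → ∀ j →
              (2 * j + 1) * suc (suc r) ≤ n → n ≤ (2 * j + 3) * suc r → j < 2 * suc r → ⊥
-- The longer chain must not overshoot `n`, and the shorter one must come within `suc r` of it;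
-- these are the two ends of the window.
even-window {r} {n} L j lo hi j< with offset (suc R + j * (suc R + suc R)) R R n (≤-trans (≤-reflexive e₁) lo) (≤-trans hi e₂)
                                    | offset (suc (R + j * (R + R))) r R n (≤-trans e₃ lo) (≤-trans hi (≤-reflexive e₄))
  where
  R = suc r
  e₁ : suc (suc r) + j * (suc (suc r) + suc (suc r)) ≡ (2 * j + 1) * suc (suc r)
  e₁ = solve (j ∷ r ∷ [])
  e₂ : (2 * j + 3) * suc r ≤ suc r + (suc (suc r) + j * (suc (suc r) + suc (suc r))) + suc r
  e₂ = ≤-trans (m≤m+n _ (2 * j + 1)) (≤-reflexive (solve (j ∷ r ∷ [])))
  e₃ : suc (suc r + j * (suc r + suc r)) ≤ (2 * j + 1) * suc (suc r)
  e₃ = ≤-trans (m≤m+n _ (2 * j)) (≤-reflexive (solve (j ∷ r ∷ [])))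
  e₄ : (2 * j + 3) * suc r ≡ r + suc (suc r + j * (suc r + suc r)) + suc r
  e₄ = solve (j ∷ r ∷ [])
... | c , c≤ , x≤n , n≤x+r | c′ , c′≤ , x′≤n , n≤x′+r = <⇒≱ j+1< (∣⇒≤ div)
  where
  open LevelCounts L
  R = suc r
  y y′ : ℕ
  y = c + suc R + j * (suc R + suc R)
  y′ = suc c′ + R + j * (R + R)
  y≡ : c + (suc R + j * (suc R + suc R)) ≡ y
  y≡ = sym (+-assoc c (suc R) _)
  y′≡ : c′ + suc (R + j * (R + R)) ≡ y′
  y′≡ = trans (+-suc c′ _) (cong suc (sym (+-assoc c′ R _)))
  l : 2 * (2 * R + 1) * suc R * suc j ≤ (2 * R + 1) * n + 2 * R * suc j
  l = subst (λ g → 2 * (2 * R + 1) * suc R * suc j ≤ g + 2 * R * suc j)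
        (G-top (subst (λ z → n ≤ z + R) y≡ n≤x+r))
        (lower L c≤ j (subst (_≤ n) y≡ x≤n))
  u : (2 * R + 1) * n ≤ (2 * (2 * R + 1) * R + (2 * R + 2)) * suc j
  u = subst (_≤ (2 * (2 * R + 1) * R + (2 * R + 2)) * suc j)
        (G-top (subst (λ z → n ≤ z + R) y′≡ n≤x′+r))
        (upper L (s≤s c′≤) j (subst (_≤ n) y′≡ x′≤n))
  -- Both bounds are `(2 R + 1)² + 1` times `suc j`, because `2 (2 R + 1) (R + 1) - 2 R = 2 (2 R +
  -- 1) R + 2 R + 2`.
  eq : (2 * R + 1) * n ≡ (2 * R + 1) * ((2 * R + 1) * suc j) + suc j
  eq = ≤-antisym (≤-trans u (≤-reflexive (e R j)))
    (farkas _ _ l (f R j n))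
    where
    e : ∀ R j → (2 * (2 * R + 1) * R + (2 * R + 2)) * suc j ≡ (2 * R + 1) * ((2 * R + 1) * suc j) + suc j
    e = solve-∀
    f : ∀ R j n → (2 * R + 1) * ((2 * R + 1) * suc j) + suc j + ((2 * R + 1) * n + 2 * R * suc j)
                  ≡ (2 * R + 1) * n + 2 * (2 * R + 1) * suc R * suc j
    f = solve-∀
  div : (2 * R + 1) ∣ suc j
  div = ∣m+n∣m⇒∣n (subst ((2 * R + 1) ∣_) eq (m∣m*n n)) (m∣m*n ((2 * R + 1) * suc j))
  j+1< : suc j < 2 * R + 1
  j+1< = ≤-trans (s≤s j<) (≤-reflexive (+-comm 1 (2 * R)))

-- Bands of rows from which all edges go up, or all go down

module Bands {r n : ℕ} (L : LevelCounts r n) where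
  open LevelCounts L

  -- All (true) or none (false) of the edge ends at heights p, …, p + w - 1 are lower ends.
  Band : Bool → ℕ → ℕ → Set
  Band true  p w = G p + 2 * (2 * r + 1) * w ≤ G (p + w)
  Band false p w = G (p + w) ≤ G p

  -- Subtracts the reflection equations at the two ends of a pair of bands. Each end may use
  -- distance `r` or `r + 1`; the four choices give `pair-up`, `pair-down`, `pair-narrow` and
  -- `pair-wide`, and a mixed choice makes the widths differ by one row.
  pair-up : ∀ p w → p + suc r + w ≤ n →
            G (p + suc r + w) + G (p + suc w) ≡
            G (p + suc r) + G p + 2 * (2 * r + 1) * w + (a (p + w) + b p)
  pair-up p w h = aux (G p) (G (p + suc r)) (G (p + suc w)) (G (p + suc r + w)) (a (p + w)) (b p) r p w
    (G-reflect p (m+n≤o⇒m≤o (p + suc r) h))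
    (subst₂ (λ x y → G x + G y ≡ 2 * (2 * r + 1) * x + a (p + w)) eq (sym (+-suc p w))
      (G-reflect′ L (p + w) (subst (_≤ n) (sym eq) h)))
    where
    eq : p + w + suc r ≡ p + suc r + w
    eq = solve (p ∷ w ∷ r ∷ [])
    aux : ∀ g g′ k k′ α β r p w → g′ + g + β ≡ 2 * (2 * r + 1) * (p + suc r) →
          k′ + k ≡ 2 * (2 * r + 1) * (p + suc r + w) + α →
          k′ + k ≡ g′ + g + 2 * (2 * r + 1) * w + (α + β)
    aux g g′ k k′ α β r p w e e′ = balance _ _ (e′ ⊞ sym e) (solve (g ∷ g′ ∷ k ∷ k′ ∷ α ∷ β ∷ r ∷ p ∷ w ∷ []))

  pair-down : ∀ p w → suc p + r + suc w ≤ n →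
              G (suc p + r + suc w) + G (suc p + w) + (a p + b (suc p + w)) ≡
              G (suc p + r) + G (suc p) + 2 * (2 * r + 1) * suc w
  pair-down p w h = aux (G (suc p)) (G (suc p + r)) (G (suc p + w)) (G (suc p + r + suc w)) (a p) (b (suc p + w)) r p w
    (subst (λ x → G x + G (suc p) ≡ 2 * (2 * r + 1) * x + a p) (+-suc p r)
      (G-reflect′ L p (subst (_≤ n) (sym (+-suc p r)) (m+n≤o⇒m≤o (suc p + r) h))))
    (subst (λ x → G x + G (suc p + w) + b (suc p + w) ≡ 2 * (2 * r + 1) * x) eq
      (G-reflect (suc p + w) (subst (_≤ n) (sym eq) h)))
    where
    eq : suc p + w + suc r ≡ suc p + r + suc w
    eq = solve (p ∷ w ∷ r ∷ [])
    aux : ∀ g g′ k k′ α β r p w → g′ + g ≡ 2 * (2 * r + 1) * (suc p + r) + α →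
          k′ + k + β ≡ 2 * (2 * r + 1) * (suc p + r + suc w) →
          k′ + k + (α + β) ≡ g′ + g + 2 * (2 * r + 1) * suc w
    aux g g′ k k′ α β r p w e e′ = balance _ _ (e′ ⊞ sym e) (solve (g ∷ g′ ∷ k ∷ k′ ∷ α ∷ β ∷ r ∷ p ∷ w ∷ []))

  pair-narrow : ∀ p w → suc p + r + w ≤ n →
                G (suc p + r + w) + G (suc p + w) + a p ≡
                G (suc p + r) + G (suc p) + 2 * (2 * r + 1) * w + a (p + w)
  pair-narrow p w h = aux (G (suc p)) (G (suc p + r)) (G (suc p + w)) (G (suc p + r + w)) (a p) (a (p + w)) r p w
    (subst (λ x → G x + G (suc p) ≡ 2 * (2 * r + 1) * x + a p) (+-suc p r)
      (G-reflect′ L p (subst (_≤ n) (sym (+-suc p r)) (m+n≤o⇒m≤o (suc p + r) h))))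
    (subst (λ x → G x + G (suc p + w) ≡ 2 * (2 * r + 1) * x + a (p + w)) eq
      (G-reflect′ L (p + w) (subst (_≤ n) (sym eq) h)))
    where
    eq : p + w + suc r ≡ suc p + r + w
    eq = solve (p ∷ w ∷ r ∷ [])
    aux : ∀ g g′ k k′ α β r p w → g′ + g ≡ 2 * (2 * r + 1) * (suc p + r) + α →
          k′ + k ≡ 2 * (2 * r + 1) * (suc p + r + w) + β →
          k′ + k + α ≡ g′ + g + 2 * (2 * r + 1) * w + β
    aux g g′ k k′ α β r p w e e′ = balance _ _ (e′ ⊞ sym e) (solve (g ∷ g′ ∷ k ∷ k′ ∷ α ∷ β ∷ r ∷ p ∷ w ∷ []))

  pair-wide : ∀ p w → p + suc r + w ≤ n →
              G (p + suc r + w) + G (p + w) + b (p + w) ≡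
              G (p + suc r) + G p + 2 * (2 * r + 1) * w + b p
  pair-wide p w h = aux (G p) (G (p + suc r)) (G (p + w)) (G (p + suc r + w)) (b p) (b (p + w)) r p w
    (G-reflect p (m+n≤o⇒m≤o (p + suc r) h))
    (subst (λ x → G x + G (p + w) + b (p + w) ≡ 2 * (2 * r + 1) * x) eq
      (G-reflect (p + w) (subst (_≤ n) (sym eq) h)))
    where
    eq : p + w + suc r ≡ p + suc r + w
    eq = solve (p ∷ w ∷ r ∷ [])
    aux : ∀ g g′ k k′ α β r p w → g′ + g + α ≡ 2 * (2 * r + 1) * (p + suc r) →
          k′ + k + β ≡ 2 * (2 * r + 1) * (p + suc r + w) →
          k′ + k + β ≡ g′ + g + 2 * (2 * r + 1) * w + α
    aux g g′ k k′ α β r p w e e′ = balance _ _ (e′ ⊞ sym e) (solve (g ∷ g′ ∷ k ∷ k′ ∷ α ∷ β ∷ r ∷ p ∷ w ∷ []))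

  -- All lower neighbours of the `w` upper rows lie in the `w + 1` rows at `p`. If no edge goes up
  -- from there, every end in the upper rows is a lower end. If all do, those that miss the upper
  -- rows number `a (p + w) + b p`, at most one row's worth, and the others fill the upper rows.
  band-up : ∀ β p w → p + suc r + w ≤ n → Band β p (suc w) → Band (not β) (p + suc r) w
  band-up true p w h B = aux (G p) (G (p + suc r)) (G (p + suc w)) (G (p + suc r + w)) (a (p + w)) (b p) r w
    (pair-up p w h) B (a≤ (p + w)) (b≤ p)
    where
    aux : ∀ g g′ k k′ α β r w → k′ + k ≡ g′ + g + 2 * (2 * r + 1) * w + (α + β) →
          g + 2 * (2 * r + 1) * suc w ≤ k → α ≤ 2 * r + 2 → β ≤ 2 * r → k′ ≤ g′
    aux g g′ k k′ α β r w e h h₁ h₂ = farkas _ _ (≤-reflexive e ⊕ h ⊕ h₁ ⊕ h₂)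
      (solve (g ∷ g′ ∷ k ∷ k′ ∷ α ∷ β ∷ r ∷ w ∷ []))
  band-up false p w h B = aux (G p) (G (p + suc r)) (G (p + suc w)) (G (p + suc r + w)) (a (p + w)) (b p) r w
    (pair-up p w h) B
    where
    aux : ∀ g g′ k k′ α β r w → k′ + k ≡ g′ + g + 2 * (2 * r + 1) * w + (α + β) →
          k ≤ g → g′ + 2 * (2 * r + 1) * w ≤ k′
    aux g g′ k k′ α β r w e h = farkas _ _ (≡⇒≥ e ⊕ h ⊕ z≤n {α + β})
      (solve (g ∷ g′ ∷ k ∷ k′ ∷ α ∷ β ∷ r ∷ w ∷ []))

  -- The same count from above: the edges that may miss the lower rows are those of `a p` and
  -- `b (suc p + w)`, which start just outside them.
  band-down : ∀ β p w → suc p + r + suc w ≤ n → Band β (suc p + r) (suc w) → Band (not β) (suc p) w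
  band-down true p w h B = aux (G (suc p)) (G (suc p + r)) (G (suc p + w)) (G (suc p + r + suc w)) (a p) (b (suc p + w)) r w
    (pair-down p w h) B
    where
    aux : ∀ g g′ k k′ α β r w → k′ + k + (α + β) ≡ g′ + g + 2 * (2 * r + 1) * suc w →
          g′ + 2 * (2 * r + 1) * suc w ≤ k′ → k ≤ g
    aux g g′ k k′ α β r w e h = farkas _ _ (≤-reflexive e ⊕ h ⊕ z≤n {α + β})
      (solve (g ∷ g′ ∷ k ∷ k′ ∷ α ∷ β ∷ r ∷ w ∷ []))
  band-down false p w h B = aux (G (suc p)) (G (suc p + r)) (G (suc p + w)) (G (suc p + r + suc w)) (a p) (b (suc p + w)) r w
    (pair-down p w h) B (a≤ p) (b≤ (suc p + w))
    where
    aux : ∀ g g′ k k′ α β r w → k′ + k + (α + β) ≡ g′ + g + 2 * (2 * r + 1) * suc w →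
          k′ ≤ g′ → α ≤ 2 * r + 2 → β ≤ 2 * r → g + 2 * (2 * r + 1) * w ≤ k
    aux g g′ k k′ α β r w e h h₁ h₂ = farkas _ _ (≡⇒≥ e ⊕ h ⊕ h₁ ⊕ h₂)
      (solve (g ∷ g′ ∷ k ∷ k′ ∷ α ∷ β ∷ r ∷ w ∷ []))

  even : ℕ → Bool
  even zero    = true
  even (suc k) = not (even k)

  bottom-band : ∀ k w → k + w ≡ r → k * suc r + w ≤ n → Band (even k) (k * suc r) w
  bottom-band zero w refl h rewrite G-bottom {0} z≤n z≤n | G-bottom {w} ≤-refl h =
    ≤-reflexive (cong (_+ 2 * (2 * w + 1) * w) (*-zeroʳ (2 * (2 * w + 1))))
  bottom-band (suc k) w eq h =
    subst (λ p → Band (not (even k)) p w) (+-comm (k * suc r) (suc r))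
      (band-up (even k) (k * suc r) w h′
        (bottom-band k (suc w) (trans (+-suc k w) eq)
          (≤-trans (≤-trans (≤-reflexive (+-suc _ w)) (≤-trans (s≤s (+-monoʳ-≤ (k * suc r) (m≤n+m w r)))
            (≤-reflexive (trans (sym (+-suc (k * suc r) (r + w))) (sym (+-assoc (k * suc r) (suc r) w)))))) h′)))
    where
    h′ : k * suc r + suc r + w ≤ n
    h′ = subst (λ p → p + w ≤ n) (+-comm (suc r) (k * suc r)) h

  -- The hypothesis `k ≤ p` provides a row beneath each band that `band-down` produces; the count
  -- `a` of that row enters there.
  top-band : ∀ k p w → k + w ≡ r → p + w + k * suc r ≡ n → k ≤ p → Band (not (even k)) p w
  top-band zero p w refl eq _ = ≤-reflexive (trans (G-top (≤-trans n≤ (m≤m+n _ w))) (sym (G-top n≤)))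
    where
    n≤ : n ≤ p + w
    n≤ = ≤-reflexive (trans (sym eq) (+-identityʳ (p + w)))
  top-band (suc k) (suc p) w eq eq′ (s≤s k≤p) =
    band-down (not (even k)) p w (≤-trans (m≤m+n _ (k * suc r)) (≤-reflexive eq″))
      (top-band k (suc p + r) (suc w) (trans (+-suc k w) eq) eq″ (m≤n⇒m≤1+n (≤-trans k≤p (m≤m+n p r))))
    where
    eq″ : suc p + r + suc w + k * suc r ≡ n
    eq″ = trans (e p r w k) eq′
      where
      e : ∀ p r w k → suc p + r + suc w + k * suc r ≡ suc p + w + suc k * suc r
      e = solve-∀

  -- A band reappears at distance σ with the opposite direction, up to a bounded error.
  Near : ℕ → ℕ → ℕ → Set
  Near σ w p = ∃₂ λ x y → x ≤ 2 * r + 2 × y ≤ 2 * r + 2 ×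
    G (p + σ + w) + G (p + w) + x ≡ G (p + σ) + G p + 2 * (2 * r + 1) * w + y

  near-narrow : ∀ w p → 0 < p → p + r + w ≤ n → Near r w p
  near-narrow w (suc p) _ h = a p , a (p + w) , a≤ p , a≤ (p + w) , pair-narrow p w h

  near-wide : ∀ w p → p + suc r + w ≤ n → Near (suc r) w p
  near-wide w p h = b (p + w) , b p , b≤′ (p + w) , b≤′ p , pair-wide p w h
    where
    b≤′ : ∀ x → b x ≤ 2 * r + 2
    b≤′ x = ≤-trans (b≤ x) (m≤m+n _ 2)

  -- The numbers of lower ends in the bands of width w at p and at q differ by at most d.
  Close : ℕ → ℕ → ℕ → ℕ → Set
  Close w p q d = (G (q + w) + G p ≤ G q + G (p + w) + d) × (G q + G (p + w) ≤ G (q + w) + G p + d)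

  -- Two reflections restore the direction: the counts at `p + σ` cancel, and in either direction
  -- only two of the four errors matter.
  near-near : ∀ σ w p → Near σ w p → Near σ w (p + σ) → Close w p (p + σ + σ) (2 * (2 * r + 2))
  near-near σ w p (x , y , x≤ , y≤ , e) (x′ , y′ , x′≤ , y′≤ , e′) =
    aux (G p) (G (p + σ)) (G (p + σ + σ)) (G (p + w)) (G (p + σ + w)) (G (p + σ + σ + w)) x y x′ y′ r _ x≤ y≤ x′≤ y′≤ e e′
    where
    aux : ∀ g g′ g″ k k′ k″ x y x′ y′ r d → x ≤ 2 * r + 2 → y ≤ 2 * r + 2 → x′ ≤ 2 * r + 2 → y′ ≤ 2 * r + 2 →
          k′ + k + x ≡ g′ + g + d + y → k″ + k′ + x′ ≡ g″ + g′ + d + y′ →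
          (k″ + g ≤ g″ + k + 2 * (2 * r + 2)) × (g″ + k ≤ k″ + g + 2 * (2 * r + 2))
    aux g g′ g″ k k′ k″ x y x′ y′ r d h₁ h₂ h₃ h₄ e e′ =
      farkas _ _ (≡⇒≥ e ⊕ ≤-reflexive e′ ⊕ h₁ ⊕ h₄ ⊕ z≤n {x′} ⊕ z≤n {y})
        (solve (g ∷ g′ ∷ g″ ∷ k ∷ k′ ∷ k″ ∷ x ∷ y ∷ x′ ∷ y′ ∷ r ∷ d ∷ [])) ,
      farkas _ _ (≤-reflexive e ⊕ ≡⇒≥ e′ ⊕ h₂ ⊕ h₃ ⊕ z≤n {x} ⊕ z≤n {y′})
        (solve (g ∷ g′ ∷ g″ ∷ k ∷ k′ ∷ k″ ∷ x ∷ y ∷ x′ ∷ y′ ∷ r ∷ d ∷ []))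

  close-chain : ∀ σ w p₀ → (∀ p → p₀ ≤ p → p + σ + w ≤ n → Near σ w p) →
                ∀ m → p₀ + m * (σ + σ) + w ≤ n →
                Close w p₀ (p₀ + m * (σ + σ)) (m * (2 * (2 * r + 2)))
  close-chain σ w p₀ near zero h rewrite +-identityʳ p₀ =
    ≤-reflexive (eq (G (p₀ + w)) (G p₀)) , ≤-reflexive (eq (G p₀) (G (p₀ + w)))
    where
    eq : ∀ x y → x + y ≡ y + x + 0
    eq = solve-∀
  close-chain σ w p₀ near (suc m) h = subst (λ x → Close w p₀ x (suc m * (2 * (2 * r + 2)))) eq
    (aux (G p₀) (G (p₀ + w)) (G q) (G (q + w)) (G (q + σ + σ)) (G (q + σ + σ + w)) _ _
      (close-chain σ w p₀ near m (≤-trans (+-monoˡ-≤ w (m≤m+n q σ)) hm))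
      (near-near σ w q (near q p₀≤q hm) (near (q + σ) (≤-trans p₀≤q (m≤m+n q σ)) h′)))
    where
    q = p₀ + m * (σ + σ)
    eq : p₀ + m * (σ + σ) + σ + σ ≡ p₀ + suc m * (σ + σ)
    eq = solve (p₀ ∷ m ∷ σ ∷ [])
    h′ : q + σ + σ + w ≤ n
    h′ = subst (λ x → x + w ≤ n) (sym eq) h
    hm : q + σ + w ≤ n
    hm = ≤-trans (+-monoˡ-≤ w (m≤m+n (q + σ) σ)) h′
    p₀≤q : p₀ ≤ q
    p₀≤q = m≤m+n p₀ _
    aux : ∀ g k g′ k′ g″ k″ d d′ →
          (k′ + g ≤ g′ + k + d) × (g′ + k ≤ k′ + g + d) →
          (k″ + g′ ≤ g″ + k′ + d′) × (g″ + k′ ≤ k″ + g′ + d′) →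
          (k″ + g ≤ g″ + k + (d′ + d)) × (g″ + k ≤ k″ + g + (d′ + d))
    aux g k g′ k′ g″ k″ d d′ (h₁ , h₂) (h₃ , h₄) =
      farkas _ _ (h₁ ⊕ h₃) (solve (g ∷ k ∷ g′ ∷ k′ ∷ g″ ∷ k″ ∷ d ∷ d′ ∷ [])) ,
      farkas _ _ (h₂ ⊕ h₄) (solve (g ∷ k ∷ g′ ∷ k′ ∷ g″ ∷ k″ ∷ d ∷ d′ ∷ []))

  clash : ∀ β w p q d → Band β p w → Band (not β) q w → Close w p q d → 2 * (2 * r + 1) * w ≤ d
  clash true w p q d B B′ (_ , h) = aux (G p) (G (p + w)) (G q) (G (q + w)) d _ B B′ h
    where
    aux : ∀ g k g′ k′ d x → g + x ≤ k → k′ ≤ g′ → g′ + k ≤ k′ + g + d → x ≤ d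
    aux g k g′ k′ d x h₁ h₂ h₃ = farkas _ _ (h₁ ⊕ h₂ ⊕ h₃) (solve (g ∷ k ∷ g′ ∷ k′ ∷ d ∷ x ∷ []))
  clash false w p q d B B′ (h , _) = aux (G p) (G (p + w)) (G q) (G (q + w)) d _ B B′ h
    where
    aux : ∀ g k g′ k′ d x → k ≤ g → g′ + x ≤ k′ → k′ + g ≤ g′ + k + d → x ≤ d
    aux g k g′ k′ d x h₁ h₂ h₃ = farkas _ _ (h₁ ⊕ h₂ ⊕ h₃) (solve (g ∷ k ∷ g′ ∷ k′ ∷ d ∷ x ∷ []))

  -- After `c` steps from each end the two bands have opposite directions, so their counts differ by
  -- `2 (2 r + 1) w`. Yet they are an even number of steps `σ` apart, which allows a difference of
  -- at most `m (4 r + 4)`.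
  clashing-bands : ∀ c m w σ → c + w ≡ r → m < w →
                   (∀ p → c * suc r ≤ p → p + σ + w ≤ n → Near σ w p) →
                   c * suc r + m * (σ + σ) + w + c * suc r ≡ n → ⊥
  clashing-bands c m w σ eq m<w near eqn =
    <⇒≱ big (clash (even c) w (c * suc r) (c * suc r + m * (σ + σ)) _
      (bottom-band c w eq (≤-trans (+-monoˡ-≤ w (m≤m+n (c * suc r) _)) h))
      (top-band c (c * suc r + m * (σ + σ)) w eq eqn
        (≤-trans (m≤m*n c (suc r)) (m≤m+n _ _)))
      (close-chain σ w (c * suc r) near m h))
    where
    h : c * suc r + m * (σ + σ) + w ≤ n
    h = m+n≤o⇒m≤o _ (≤-reflexive eqn)
    big : m * (2 * (2 * r + 2)) < 2 * (2 * r + 1) * w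
    big = aux r m w m<w (≤-trans (<⇒≤ m<w) (≤-trans (m≤n+m w c) (≤-reflexive eq)))
      where
      aux : ∀ r m w → m < w → m ≤ r → m * (2 * (2 * r + 2)) < 2 * (2 * r + 1) * w
      -- At the worst width `w = m + 1` the margin is `2 (2 r + 1) - 2 m`, positive because `m ≤ r`.
      aux r m w m<w m≤r = ≤-trans (farkas (suc (m * (2 * (2 * r + 2)))) (2 * (2 * r + 1) * suc m)
        (m≤r ⊕ m≤r ⊕ z≤n {2 * r + 1})
        (solve (r ∷ m ∷ []))) (*-monoʳ-≤ (2 * (2 * r + 1)) m<w)

-- Follow the bottom bands and the top bands c steps each, until their width has shrunk to
-- r - c; they face each other with opposite directions at distance 2 (j - c) σ.
odd-window : ∀ {r n} → LevelCounts r n → ∀ j e → j < r → 0 < e → e ≤ 2 * j → n ≡ (2 * j + 1) * r + e → ⊥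
odd-window {r} {n} L j e j<r 0<e e≤ refl with e ≤? j
-- For `σ = r` the two bands and the distance between them add up to `(2 j + 1) r + c`, whence
-- `c = e`.
... | yes e≤j = clashing-bands e (j ∸ e) (r ∸ e) r (m+[n∸m]≡n (<⇒≤ (≤-<-trans e≤j j<r)))
      (∸-monoˡ-< j<r e≤j)
      (λ p h → near-narrow _ p (≤-trans (*-mono-≤ 0<e (s≤s z≤n)) h))
      (lemma e (j ∸ e) (r ∸ e) (m+[n∸m]≡n e≤j) (m+[n∸m]≡n (<⇒≤ (≤-<-trans e≤j j<r))))
  where
  open Bands L
  lemma : ∀ c m w {j r} → c + m ≡ j → c + w ≡ r →
          c * suc r + m * (r + r) + w + c * suc r ≡ (2 * j + 1) * r + c
  lemma c m w refl refl = solve (c ∷ m ∷ w ∷ [])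
... | no e≰j = clashing-bands c (j ∸ c) (r ∸ c) (suc r) (m+[n∸m]≡n (<⇒≤ (≤-<-trans c≤j j<r)))
      (∸-monoˡ-< j<r c≤j)
      (λ p _ → near-wide _ p)
      (lemma c (j ∸ c) (r ∸ c) e (m+[n∸m]≡n c≤j) (m+[n∸m]≡n (<⇒≤ (≤-<-trans c≤j j<r))) c+e)
  where
  open Bands L
  -- For `σ = r + 1` the total height is `(2 j + 1) r + 2 j - c`.
  c = 2 * j ∸ e
  c+e : c + e ≡ 2 * j
  c+e = m∸n+n≡m e≤
  c≤j : c ≤ j
  c≤j = +-cancelʳ-≤ j c j (≤-trans (+-monoʳ-≤ c (<⇒≤ (≰⇒> e≰j))) (≤-reflexive (trans c+e (cong (j +_) (+-identityʳ j)))))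
  lemma : ∀ c m w e {j r} → c + m ≡ j → c + w ≡ r → c + e ≡ 2 * j →
          c * suc r + m * (suc r + suc r) + w + c * suc r ≡ (2 * j + 1) * r + e
  lemma c m w e refl refl h = balance _ _ (sym h) (solve (c ∷ m ∷ w ∷ e ∷ []))

-- Division by `2 (r + 1)` places `n` between `(2 j + 1) (r + 1)` and `(2 j + 3) (r + 1)`; the point
-- `(2 j + 3) r` separates the two windows. In the second, `(2 j + 3) r < n ≤ (2 r + 1) r` yields
-- the required `j + 1 < r`.
no-level-counts : ∀ {r n} → 0 < r → 0 < n → n ≤ 2 * (r * r) + r → LevelCounts r n → ⊥
no-level-counts {suc r} {n} _ 0<n n≤ L with n ≤? suc r
... | yes n≤r = <⇒≢ (*-mono-≤ (m≤n+m 1 (2 * suc r)) 0<n)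
    (trans (sym (trans (G-bottom z≤n z≤n) (*-zeroʳ (2 * (2 * suc r + 1))))) (G-top n≤r))
  where open LevelCounts L
... | no n≰r with (n ∸ suc (suc r)) / (suc (suc r) + suc (suc r)) | (n ∸ suc (suc r)) % (suc (suc r) + suc (suc r))
                | m≡m%n+[m/n]*n (n ∸ suc (suc r)) (suc (suc r) + suc (suc r)) | m%n<n (n ∸ suc (suc r)) (suc (suc r) + suc (suc r))
... | j | ρ | eq | ρ< with n ≤? (2 * j + 3) * suc r
... | yes n≤′ = even-window L j lo n≤′ (≤-trans j<r (m≤m+n (suc r) _))
  where
  n≡ : n ≡ suc (suc r) + (ρ + j * (suc (suc r) + suc (suc r)))
  n≡ = trans (sym (m+[n∸m]≡n (≰⇒> n≰r))) (cong (suc (suc r) +_) eq)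
  lo : (2 * j + 1) * suc (suc r) ≤ n
  lo = ≤-trans (m≤m+n _ ρ) (≤-reflexive (trans (e r j ρ) (sym n≡)))
    where
    e : ∀ r j ρ → (2 * j + 1) * suc (suc r) + ρ ≡ suc (suc r) + (ρ + j * (suc (suc r) + suc (suc r)))
    e = solve-∀
  j<r : j < suc r
  j<r = *-cancelˡ-< 2 _ _ (+-cancelʳ-< 1 _ _ (*-cancelʳ-< (suc (suc r)) _ _ (≤-<-trans (≤-trans lo n≤) (f r))))
    where
    f : ∀ r → 2 * (suc r * suc r) + suc r < (2 * suc r + 1) * suc (suc r)
    f r = ≤-trans (m≤m+n _ (2 * suc r)) (≤-reflexive (solve (r ∷ [])))
... | no n≰ = odd-window L (suc j) e (*-cancelˡ-< 2 _ _ (+-cancelʳ-< 1 _ _ (*-cancelʳ-< (suc r) _ _ h₁))) (m<n⇒0<n∸m {_} (≰⇒> n≰)) h₂ n≡′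
  where
  n≡ : n ≡ suc (suc r) + (ρ + j * (suc (suc r) + suc (suc r)))
  n≡ = trans (sym (m+[n∸m]≡n (≰⇒> n≰r))) (cong (suc (suc r) +_) eq)
  e = n ∸ (2 * j + 3) * suc r
  e≡ : (2 * j + 3) * suc r + e ≡ n
  e≡ = m+[n∸m]≡n (<⇒≤ (≰⇒> n≰))
  idx : ∀ j → 2 * j + 3 ≡ 2 * suc j + 1
  idx = solve-∀
  n≡′ : n ≡ (2 * suc j + 1) * suc r + e
  n≡′ = trans (sym e≡) (cong (λ z → z * suc r + e) (idx j))
  h₁ : (2 * suc j + 1) * suc r < (2 * suc r + 1) * suc r
  h₁ = ≤-trans (≤-trans (≤-reflexive (cong (λ z → suc (z * suc r)) (sym (idx j)))) (≰⇒> n≰)) (≤-trans n≤ (≤-reflexive (f r)))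
    where
    f : ∀ r → 2 * (suc r * suc r) + suc r ≡ (2 * suc r + 1) * suc r
    f = solve-∀
  h₂ : e ≤ 2 * suc j
  h₂ = aux r j ρ e (trans e≡ n≡) ρ<
    where
    aux : ∀ r j ρ e → (2 * j + 3) * suc r + e ≡ suc (suc r) + (ρ + j * (suc (suc r) + suc (suc r))) →
          ρ < suc (suc r) + suc (suc r) → e ≤ 2 * suc j
    aux r j ρ e h h′ = farkas _ _ (≤-reflexive h ⊕ h′) (solve (r ∷ j ∷ ρ ∷ e ∷ []))

-- The cyclic successor as a permutation

module _ {k : ℕ} where
  csuc-last : ∀ {i : Fin (suc k)} → k ≡ toℕ i → csuc i ≡ Fin.zero
  csuc-last {i} eq with k ≟ toℕ i
  ... | yes _ = refl
  ... | no ne = contradiction eq ne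

  csuc-inner : ∀ {i : Fin (suc k)} (ne : k ≢ toℕ i) → csuc i ≡ Fin.suc (lower₁ i ne)
  csuc-inner {i} ne with k ≟ toℕ i
  ... | yes eq = contradiction eq ne
  ... | no _ = cong Fin.suc (Fin.lower₁-irrelevant i _ _)

cpred : ∀ {k} → Fin k → Fin k
cpred {suc k} Fin.zero    = fromℕ k
cpred {suc k} (Fin.suc i) = inject₁ i

csuc-cpred : ∀ {k} (i : Fin k) → csuc (cpred i) ≡ i
csuc-cpred {suc k} Fin.zero    = csuc-last (sym (Fin.toℕ-fromℕ k))
csuc-cpred {suc k} (Fin.suc i) =
  trans (csuc-inner ne) (cong Fin.suc (Fin.lower₁-inject₁′ i ne))
  where
  ne : k ≢ toℕ (inject₁ i)
  ne eq = <⇒≢ (Fin.toℕ<n i) (sym (trans eq (Fin.toℕ-inject₁ i)))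

cpred-csuc : ∀ {k} (i : Fin k) → cpred (csuc i) ≡ i
cpred-csuc {suc k} i with k ≟ toℕ i
... | yes eq = Fin.toℕ-injective (trans (Fin.toℕ-fromℕ k) eq)
... | no ne  = Fin.inject₁-lower₁ i ne

csuc-injective : ∀ {k} {i j : Fin k} → csuc i ≡ csuc j → i ≡ j
csuc-injective {i = i} {j} eq = trans (sym (cpred-csuc i)) (trans (cong cpred eq) (cpred-csuc j))

toℕ-csuc : ∀ {k} (i : Fin k) → suc (toℕ i) < k → toℕ (csuc i) ≡ suc (toℕ i)
toℕ-csuc {suc k} i (s≤s lt) = trans (cong toℕ (csuc-inner ne)) (cong suc (Fin.toℕ-lower₁ i ne))
  where
  ne : k ≢ toℕ i
  ne = λ eq → <⇒≢ lt (sym eq)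

-- Rules out a circuit that runs back and forth along one edge, so that distinct indices stand for
-- distinct edges.
csuc²-≢ : ∀ {k} → 3 ≤ k → (i : Fin k) → csuc (csuc i) ≢ i
csuc²-≢ {suc k} (s≤s 2≤k) i eq with k ≟ toℕ i
... | yes k≡i = <⇒≢ (≤-trans (≤-reflexive (cong suc (toℕ-csuc Fin.zero (s≤s (≤-trans (s≤s z≤n) 2≤k))))) 2≤k)
                  (trans (cong toℕ eq) (sym k≡i))
... | no k≢i with k ≟ suc (toℕ (lower₁ i k≢i))
... | yes k≡1+i = <⇒≢ 2≤k (trans (cong (λ z → suc (toℕ z)) eq) (trans (cong suc (sym (Fin.toℕ-lower₁ i k≢i))) (sym k≡1+i)))
... | no k≢1+i = <⇒≢ (≤-trans (n≤1+n _) ≤-refl)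
    (trans (sym (cong toℕ eq)) (cong suc (trans (Fin.toℕ-lower₁ _ k≢1+i) (cong suc (Fin.toℕ-lower₁ i k≢i)))))

-- Climb from `i` to the last index, wrap round to `zero`, and climb again to `j`.
csuc-induction : ∀ {k} (P : Fin k → Set) → (∀ i → P i → P (csuc i)) → ∀ {i} → P i → ∀ j → P j
csuc-induction {suc k} P step {i} Pi j =
  from-zero (toℕ j) j refl (subst P (csuc-last refl′) (step (fromℕ k) (to-last (k ∸ toℕ i) i (m∸n+n≡m (≤-pred (Fin.toℕ<n i))) Pi)))
  where
  refl′ : k ≡ toℕ (fromℕ k)
  refl′ = sym (Fin.toℕ-fromℕ k)
  to-last : ∀ d i → d + toℕ i ≡ k → P i → P (fromℕ k)
  to-last zero    i eq Pi = subst P (Fin.toℕ-injective (trans eq refl′)) Pi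
  to-last (suc d) i eq Pi = to-last d (csuc i)
    (trans (cong (d +_) (toℕ-csuc i (s≤s (≤-trans (s≤s (m≤n+m (toℕ i) d)) (≤-reflexive eq))))) (trans (+-suc d (toℕ i)) eq))
    (step i Pi)
  from-zero : ∀ d j → toℕ j ≡ d → P Fin.zero → P j
  from-zero zero    j eq P0 = subst P (Fin.toℕ-injective (sym eq)) P0
  from-zero (suc d) (Fin.suc j) eq P0 = subst P (csuc-cpred (Fin.suc j))
    (step (inject₁ j) (from-zero d (inject₁ j) (trans (Fin.toℕ-inject₁ j) (suc-injective eq)) P0))

csuc-permutation : ∀ k → Permutation k k
csuc-permutation k = permutation csuc cpred csuc-cpred cpred-csuc

-- Finite sums and counting

sum-mono : ∀ {k} {f g : Fin k → ℕ} → (∀ i → f i ≤ g i) → sum f ≤ sum g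
sum-mono {zero}  h = z≤n
sum-mono {suc k} h = +-mono-≤ (h Fin.zero) (sum-mono (λ i → h (Fin.suc i)))

sum-const : ∀ k x → sum {k} (λ _ → x) ≡ k * x
sum-const zero    x = refl
sum-const (suc k) x = cong (x +_) (sum-const k x)

term≤sum : ∀ {k} (f : Fin k → ℕ) i → f i ≤ sum f
term≤sum f Fin.zero    = m≤m+n _ _
term≤sum f (Fin.suc i) = ≤-trans (term≤sum (λ j → f (Fin.suc j)) i) (m≤n+m _ _)

⟦_⟧ : ∀ {p} {P : Set p} → Dec P → ℕ
⟦ d ⟧ = if does d then 1 else 0

module _ {P : Set} where
  ⟦⟧-true : (d : Dec P) → P → ⟦ d ⟧ ≡ 1
  ⟦⟧-true (yes _) p = refl
  ⟦⟧-true (no ¬p) p = contradiction p ¬p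

  ⟦⟧-false : (d : Dec P) → ¬ P → ⟦ d ⟧ ≡ 0
  ⟦⟧-false (yes p) ¬p = contradiction p ¬p
  ⟦⟧-false (no _)  ¬p = refl

  ⟦⟧≤1 : (d : Dec P) → ⟦ d ⟧ ≤ 1
  ⟦⟧≤1 (yes _) = ≤-refl
  ⟦⟧≤1 (no _)  = z≤n

  ⟦⟧-cong : ∀ {Q : Set} (d : Dec P) (e : Dec Q) → (P → Q) → (Q → P) → ⟦ d ⟧ ≡ ⟦ e ⟧
  ⟦⟧-cong (yes p) e f g = sym (⟦⟧-true′ e (f p))
    where
    ⟦⟧-true′ : ∀ {Q : Set} (e : Dec Q) → Q → ⟦ e ⟧ ≡ 1
    ⟦⟧-true′ (yes _) q = refl
    ⟦⟧-true′ (no ¬q) q = contradiction q ¬q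
  ⟦⟧-cong (no ¬p) (yes q) f g = contradiction (g q) ¬p
  ⟦⟧-cong (no ¬p) (no _)  f g = refl

module _ {k} {P : Fin k → Set} (P? : ∀ i → Dec (P i)) where
  count : ℕ
  count = sum (λ i → ⟦ P? i ⟧)

  count-none : (∀ i → ¬ P i) → count ≡ 0
  count-none h = trans (sum-cong-≗ (λ i → ⟦⟧-false (P? i) (h i))) (trans (sum-const k 0) (*-zeroʳ k))

  count-some : ∀ {i} → P i → 1 ≤ count
  count-some {i} p = ≤-trans (≤-reflexive (sym (⟦⟧-true (P? i) p))) (term≤sum (λ i → ⟦ P? i ⟧) i)

  count-all : (∀ i → P i) → count ≡ k
  count-all h = trans (sum-cong-≗ (λ i → ⟦⟧-true (P? i) (h i))) (trans (sum-const k 1) (*-identityʳ k))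

count≤1 : ∀ {k} {P : Fin k → Set} (P? : ∀ i → Dec (P i)) → (∀ {i j} → P i → P j → i ≡ j) → count P? ≤ 1
count≤1 {zero}  P? h = z≤n
count≤1 {suc k} {P} P? h with P? Fin.zero
... | yes p = s≤s (≤-reflexive (count-none (λ i → P? (Fin.suc i)) λ i q → contradiction (h p q) λ ()))
... | no _  = count≤1 (λ i → P? (Fin.suc i)) (λ p q → Fin.suc-injective (h p q))

count-unique : ∀ {k} {P : Fin k → Set} (P? : ∀ i → Dec (P i)) {i} → P i → (∀ {i j} → P i → P j → i ≡ j) → count P? ≡ 1
count-unique P? p h = ≤-antisym (count≤1 P? h) (count-some P? p)

count-witness : ∀ {k} {P : Fin k → Set} (P? : ∀ i → Dec (P i)) → 1 ≤ count P? → ∃ P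
count-witness P? h with Fin.any? P?
... | yes p = p
... | no ¬p = contradiction (count-none P? (λ i q → ¬p (i , q))) (<⇒≢ h ∘ sym)

extremes : ∀ y y′ → (y ≡ y ⊓ y′ × y′ ≡ y ⊓ y′ + ∣ y - y′ ∣) ⊎ (y′ ≡ y ⊓ y′ × y ≡ y ⊓ y′ + ∣ y - y′ ∣)
extremes zero     y′       = inj₁ (refl , refl)
extremes (suc y)  zero     = inj₂ (refl , refl)
extremes (suc y)  (suc y′) with extremes y y′
... | inj₁ (e , e′) = inj₁ (cong suc e , cong suc e′)
... | inj₂ (e , e′) = inj₂ (cong suc e , cong suc e′)

-- The level counts of a Hamiltonian circuit

module Circuit {r n : ℕ} (H : LeaperHamiltonian r (suc r) (2 * r + 1) n) where
  open HamiltonianCircuit H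

  N : ℕ
  N = (2 * r + 1) * n

  X Y : Fin N → ℕ
  X t = toℕ (proj₁ (c t))
  Y t = toℕ (proj₂ (c t))

  X< : ∀ t → X t < 2 * r + 1
  X< t = Fin.toℕ<n (proj₁ (c t))

  Y< : ∀ t → Y t < n
  Y< t = Fin.toℕ<n (proj₂ (c t))

  At : ℕ × ℕ → Fin N → Set
  At (x , y) t = X t ≡ x × Y t ≡ y

  At? : ∀ v t → Dec (At v t)
  At? (x , y) t = (X t ≟ x) ×-dec (Y t ≟ y)

  At-injective : ∀ {v t t′} → At v t → At v t′ → t ≡ t′
  At-injective (e₁ , e₂) (e₃ , e₄) =
    inj (cong₂ _,_ (Fin.toℕ-injective (trans e₁ (sym e₃))) (Fin.toℕ-injective (trans e₂ (sym e₄))))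

  At-functional : ∀ {v w t} → At v t → At w t → v ≡ w
  At-functional (refl , refl) (refl , refl) = refl

  At-exists : ∀ {x y} → x < 2 * r + 1 → y < n → ∃ (At (x , y))
  At-exists x< y< with surj (fromℕ< x< , fromℕ< y<)
  ... | t , h = t , trans (cong (λ v → toℕ (proj₁ v)) (h refl)) (Fin.toℕ-fromℕ< x<)
                  , trans (cong (λ v → toℕ (proj₂ v)) (h refl)) (Fin.toℕ-fromℕ< y<)

  -- Index `t` stands for the edge between `c t` and `c (csuc t)`, with its orientation forgotten.
  Joins : ℕ × ℕ → ℕ × ℕ → Fin N → Set
  Joins v w t = (At v t × At w (csuc t)) ⊎ (At w t × At v (csuc t))

  Joins? : ∀ v w t → Dec (Joins v w t)
  Joins? v w t = (At? v t ×-dec At? w (csuc t)) ⊎-dec (At? w t ×-dec At? v (csuc t))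

  Joins-unique : ∀ {v w t t′} → Joins v w t → Joins v w t′ → t ≡ t′
  Joins-unique (inj₁ (p , q)) (inj₁ (p′ , q′)) = At-injective p p′
  Joins-unique (inj₂ (p , q)) (inj₂ (p′ , q′)) = At-injective p p′
  Joins-unique {t′ = t′} (inj₁ (p , q)) (inj₂ (p′ , q′)) =
    contradiction (trans (cong csuc (sym (At-injective p q′))) (sym (At-injective p′ q))) (csuc²-≢ atLeast3 t′)
  Joins-unique {t′ = t′} (inj₂ (p , q)) (inj₁ (p′ , q′)) =
    contradiction (trans (cong csuc (sym (At-injective p q′))) (sym (At-injective p′ q))) (csuc²-≢ atLeast3 t′)

  edge : ℕ × ℕ → ℕ × ℕ → ℕ
  edge v w = count (Joins? v w)

  edge≤1 : ∀ v w → edge v w ≤ 1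
  edge≤1 v w = count≤1 (Joins? v w) Joins-unique

  low gap : Fin N → ℕ
  low t = Y t ⊓ Y (csuc t)
  gap t = ∣ Y t - Y (csuc t) ∣

  high< : ∀ t → low t + gap t < n
  high< t with extremes (Y t) (Y (csuc t))
  ... | inj₁ (_ , e) = subst (_< n) e (Y< (csuc t))
  ... | inj₂ (_ , e) = subst (_< n) e (Y< t)

  gap-cases : ∀ t → (∣ X t - X (csuc t) ∣ ≡ r × gap t ≡ suc r) ⊎ (∣ X t - X (csuc t) ∣ ≡ suc r × gap t ≡ r)
  gap-cases = adj

  r≤gap : ∀ t → r ≤ gap t
  r≤gap t with gap-cases t
  ... | inj₁ (_ , e) = ≤-trans (n≤1+n r) (≤-reflexive (sym e))
  ... | inj₂ (_ , e) = ≤-reflexive (sym e)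

  column : ∀ {y} → y < n → count (λ t → Y t ≟ y) ≡ 2 * r + 1
  column {y} y<n = begin
    sum (λ t → ⟦ Y t ≟ y ⟧)
      ≡⟨ sum-cong-≗ split ⟩
    sum (λ t → sum {2 * r + 1} (λ x → ⟦ At? (toℕ x , y) t ⟧))
      ≡⟨ ∑-comm (λ t (x : Fin (2 * r + 1)) → ⟦ At? (toℕ x , y) t ⟧) ⟩
    sum {2 * r + 1} (λ x → count (At? (toℕ x , y)))
      ≡⟨ sum-cong-≗ (λ x → count-unique (At? (toℕ x , y)) (proj₂ (At-exists (Fin.toℕ<n x) y<n)) At-injective) ⟩
    sum {2 * r + 1} (λ _ → 1)
      ≡⟨ trans (sum-const (2 * r + 1) 1) (*-identityʳ _) ⟩
    2 * r + 1 ∎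
    where
    open ≡-Reasoning
    split : ∀ t → ⟦ Y t ≟ y ⟧ ≡ sum (λ (x : Fin (2 * r + 1)) → ⟦ At? (toℕ x , y) t ⟧)
    split t = by-cases (Y t ≟ y)
      where
      by-cases : Dec (Y t ≡ y) → ⟦ Y t ≟ y ⟧ ≡ sum (λ (x : Fin (2 * r + 1)) → ⟦ At? (toℕ x , y) t ⟧)
      by-cases (no ne) = trans (⟦⟧-false (Y t ≟ y) ne)
        (sym (count-none (λ (x : Fin (2 * r + 1)) → At? (toℕ x , y) t) (λ x p → ne (proj₂ p))))
      by-cases (yes e) = trans (⟦⟧-true (Y t ≟ y) e)
        (sym (count-unique (λ (x : Fin (2 * r + 1)) → At? (toℕ x , y) t) {proj₁ (c t)} (refl , e)
          (λ p q → Fin.toℕ-injective (trans (sym (proj₁ p)) (proj₁ q)))))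

  columns : ∀ {x} → x ≤ n → count (λ t → Y t <? x) ≡ (2 * r + 1) * x
  columns {zero}  _ = trans (count-none (λ t → Y t <? 0) (λ _ ())) (sym (*-zeroʳ (2 * r + 1)))
  columns {suc x} h = begin
    count (λ t → Y t <? suc x)
      ≡⟨ sum-cong-≗ (λ t → split (Y t)) ⟩
    sum (λ t → ⟦ Y t <? x ⟧ + ⟦ Y t ≟ x ⟧)
      ≡⟨ ∑-distrib-+ (λ t → ⟦ Y t <? x ⟧) (λ t → ⟦ Y t ≟ x ⟧) ⟩
    count (λ t → Y t <? x) + count (λ t → Y t ≟ x)
      ≡⟨ cong₂ _+_ (columns (<⇒≤ h)) (column h) ⟩
    (2 * r + 1) * x + (2 * r + 1)
      ≡⟨ trans (+-comm _ (2 * r + 1)) (sym (*-suc (2 * r + 1) x)) ⟩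
    (2 * r + 1) * suc x ∎
    where
    open ≡-Reasoning
    split : ∀ y → ⟦ y <? suc x ⟧ ≡ ⟦ y <? x ⟧ + ⟦ y ≟ x ⟧
    split y with <-cmp y x
    ... | tri< lt ne _ = trans (⟦⟧-true (y <? suc x) (m<n⇒m<1+n lt)) (sym (cong₂ _+_ (⟦⟧-true (y <? x) lt) (⟦⟧-false (y ≟ x) ne)))
    ... | tri≈ nlt e _ = trans (⟦⟧-true (y <? suc x) (s≤s (≤-reflexive e))) (sym (cong₂ _+_ (⟦⟧-false (y <? x) nlt) (⟦⟧-true (y ≟ x) e)))
    ... | tri> nlt ne gt = trans (⟦⟧-false (y <? suc x) (≤⇒≯ gt)) (sym (cong₂ _+_ (⟦⟧-false (y <? x) nlt) (⟦⟧-false (y ≟ x) ne)))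

  sum-csuc : ∀ (f : Fin N → ℕ) → sum (λ t → f (csuc t)) ≡ sum f
  sum-csuc f = sym (sum-permute f (csuc-permutation N))

  a? : ∀ h t → Dec (low t ≡ h × gap t ≡ suc r)
  a? h t = (low t ≟ h) ×-dec (gap t ≟ suc r)

  b? : ∀ h t → Dec (low t ≡ h × gap t ≡ r)
  b? h t = (low t ≟ h) ×-dec (gap t ≟ r)

  G a b : ℕ → ℕ
  G x = count (λ t → low t <? x)
  a h = count (a? h)
  b h = count (b? h)

  -- Every vertex is an end of two edges, once as `c t` and once as `c (csuc t)`; the shift by
  -- `csuc` leaves the sum unchanged.
  double-count : ∀ {x} → x ≤ n → G x + count (λ t → low t + gap t <? x) ≡ 2 * (2 * r + 1) * x
  double-count {x} x≤n = begin
    G x + count (λ t → low t + gap t <? x)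
      ≡⟨ ∑-distrib-+ (λ t → ⟦ low t <? x ⟧) (λ t → ⟦ low t + gap t <? x ⟧) ⟨
    sum (λ t → ⟦ low t <? x ⟧ + ⟦ low t + gap t <? x ⟧)
      ≡⟨ sum-cong-≗ ends ⟩
    sum (λ t → ⟦ Y t <? x ⟧ + ⟦ Y (csuc t) <? x ⟧)
      ≡⟨ ∑-distrib-+ (λ t → ⟦ Y t <? x ⟧) (λ t → ⟦ Y (csuc t) <? x ⟧) ⟩
    count (λ t → Y t <? x) + sum (λ t → ⟦ Y (csuc t) <? x ⟧)
      ≡⟨ cong (count (λ t → Y t <? x) +_) (sum-csuc (λ t → ⟦ Y t <? x ⟧)) ⟩
    count (λ t → Y t <? x) + count (λ t → Y t <? x)
      ≡⟨ cong₂ _+_ (columns x≤n) (columns x≤n) ⟩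
    (2 * r + 1) * x + (2 * r + 1) * x
      ≡⟨ e r x ⟩
    2 * (2 * r + 1) * x ∎
    where
    open ≡-Reasoning
    e : ∀ r x → (2 * r + 1) * x + (2 * r + 1) * x ≡ 2 * (2 * r + 1) * x
    e = solve-∀
    ends : ∀ t → ⟦ low t <? x ⟧ + ⟦ low t + gap t <? x ⟧ ≡ ⟦ Y t <? x ⟧ + ⟦ Y (csuc t) <? x ⟧
    ends t with extremes (Y t) (Y (csuc t))
    ... | inj₁ (e , e′) = sym (cong₂ (λ y y′ → ⟦ y <? x ⟧ + ⟦ y′ <? x ⟧) e e′)
    ... | inj₂ (e , e′) = trans (+-comm ⟦ low t <? x ⟧ _) (sym (cong₂ (λ y y′ → ⟦ y <? x ⟧ + ⟦ y′ <? x ⟧) e′ e))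

  ab-count : ∀ x → G (suc x) ≡ G x + (a x + b x)
  ab-count x = trans (sum-cong-≗ split)
    (trans (∑-distrib-+ (λ t → ⟦ low t <? x ⟧) _) (cong (G x +_) (∑-distrib-+ (λ t → ⟦ a? x t ⟧) _)))
    where
    split : ∀ t → ⟦ low t <? suc x ⟧ ≡ ⟦ low t <? x ⟧ + (⟦ a? x t ⟧ + ⟦ b? x t ⟧)
    split t with <-cmp (low t) x | gap-cases t
    ... | tri< lt ne _ | _ = trans (⟦⟧-true (low t <? suc x) (m<n⇒m<1+n lt))
        (sym (cong₂ _+_ (⟦⟧-true (low t <? x) lt) (cong₂ _+_ (⟦⟧-false (a? x t) (λ z → ne (proj₁ z))) (⟦⟧-false (b? x t) (λ z → ne (proj₁ z))))))
    ... | tri> nlt ne gt | _ = trans (⟦⟧-false (low t <? suc x) (≤⇒≯ gt))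
        (sym (cong₂ _+_ (⟦⟧-false (low t <? x) nlt) (cong₂ _+_ (⟦⟧-false (a? x t) (λ z → ne (proj₁ z))) (⟦⟧-false (b? x t) (λ z → ne (proj₁ z))))))
    ... | tri≈ nlt e _ | inj₁ (_ , g) = trans (⟦⟧-true (low t <? suc x) (s≤s (≤-reflexive e)))
        (sym (cong₂ _+_ (⟦⟧-false (low t <? x) nlt) (cong₂ _+_ (⟦⟧-true (a? x t) (e , g)) (⟦⟧-false (b? x t) (λ z → 1+n≢n (trans (sym g) (proj₂ z)))))))
    ... | tri≈ nlt e _ | inj₂ (_ , g) = trans (⟦⟧-true (low t <? suc x) (s≤s (≤-reflexive e)))
        (sym (cong₂ _+_ (⟦⟧-false (low t <? x) nlt) (cong₂ _+_ (⟦⟧-false (a? x t) (λ z → 1+n≢n (trans (sym (proj₂ z)) g))) (⟦⟧-true (b? x t) (e , g)))))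

  -- An upper end lies below `x + r + 1` when the lower end is below `x`, or is at `x` itself and
  -- the gap is only `r`.
  high-count : ∀ x → count (λ t → low t + gap t <? x + suc r) ≡ G x + b x
  high-count x = trans (sum-cong-≗ split) (∑-distrib-+ (λ t → ⟦ low t <? x ⟧) _)
    where
    split : ∀ t → ⟦ low t + gap t <? x + suc r ⟧ ≡ ⟦ low t <? x ⟧ + ⟦ b? x t ⟧
    split t with gap-cases t
    ... | inj₁ (_ , g) = trans (⟦⟧-cong (low t + gap t <? x + suc r) (low t <? x)
            (λ h → +-cancelʳ-< (suc r) _ _ (subst (λ z → low t + z < x + suc r) g h))
            (λ h → subst (λ z → low t + z < x + suc r) (sym g) (+-monoˡ-< (suc r) h)))
          (trans (sym (+-identityʳ _)) (cong (⟦ low t <? x ⟧ +_) (sym (⟦⟧-false (b? x t) (λ z → 1+n≢n (trans (sym g) (proj₂ z)))))))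
    ... | inj₂ (_ , g) with <-cmp (low t) x
    ... | tri< lt ne _ = trans (⟦⟧-true (low t + gap t <? x + suc r)
              (subst (λ z → low t + z < x + suc r) (sym g) (+-mono-<-≤ lt (n≤1+n r))))
            (sym (cong₂ _+_ (⟦⟧-true (low t <? x) lt) (⟦⟧-false (b? x t) (λ z → ne (proj₁ z)))))
    ... | tri≈ nlt e _ = trans (⟦⟧-true (low t + gap t <? x + suc r)
              (subst₂ (λ y z → y + z < x + suc r) (sym e) (sym g) (+-monoʳ-< x (n<1+n r))))
            (sym (cong₂ _+_ (⟦⟧-false (low t <? x) nlt) (⟦⟧-true (b? x t) (e , g))))
    ... | tri> nlt ne gt = trans (⟦⟧-false (low t + gap t <? x + suc r)
              (λ h → <⇒≱ (subst (λ z → low t + z < x + suc r) g h) (≤-trans (≤-reflexive (+-suc x r)) (+-monoˡ-≤ r gt))))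
            (sym (cong₂ _+_ (⟦⟧-false (low t <? x) nlt) (⟦⟧-false (b? x t) (λ z → ne (proj₁ z)))))

  endpoints : ∀ t → ∃₂ λ x x′ → Joins (x , low t) (x′ , low t + gap t) t × ∣ x - x′ ∣ ≡ ∣ X t - X (csuc t) ∣
                              × x < 2 * r + 1 × x′ < 2 * r + 1
  endpoints t with extremes (Y t) (Y (csuc t))
  ... | inj₁ (e , e′) = X t , X (csuc t) , inj₁ ((refl , e) , (refl , e′)) , refl , X< t , X< (csuc t)
  ... | inj₂ (e , e′) = X (csuc t) , X t , inj₂ ((refl , e′) , (refl , e)) , ∣-∣-comm (X (csuc t)) (X t) , X< (csuc t) , X< t

  -- Counts the circuit edges among the two diagonals of a `d` by `g` rectangle.
  slanted : ℕ → ℕ → ℕ → ℕ → ℕ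
  slanted h g d k = edge (k , h) (k + d , h + g) + edge (k + d , h) (k , h + g)

  slanted≤2 : ∀ h g d k → slanted h g d k ≤ 2
  slanted≤2 h g d k = +-mono-≤ (edge≤1 (k , h) (k + d , h + g)) (edge≤1 (k + d , h) (k , h + g))

  -- The bound is kept as a sum over single board edges: the capacities follow from it, and for
  -- `r = 4` a level that attains its capacity forces each of these edges.
  level-count : ∀ h g d m → d + m ≡ 2 * r + 1 → (∀ t → gap t ≡ g → ∣ X t - X (csuc t) ∣ ≡ d) →
                count (λ t → (low t ≟ h) ×-dec (gap t ≟ g)) ≤ sum {m} (λ k → slanted h g d (toℕ k))
  level-count h g d m d+m≡ dx = ≤-trans (sum-mono pointwise) (≤-reflexive (begin
    sum (λ t → sum {m} (λ k → ⟦ up k t ⟧ + ⟦ down k t ⟧))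
      ≡⟨ ∑-comm (λ t (k : Fin m) → ⟦ up k t ⟧ + ⟦ down k t ⟧) ⟩
    sum {m} (λ k → sum (λ t → ⟦ up k t ⟧ + ⟦ down k t ⟧))
      ≡⟨ sum-cong-≗ {m} (λ k → ∑-distrib-+ (λ t → ⟦ up k t ⟧) (λ t → ⟦ down k t ⟧)) ⟩
    sum {m} (λ k → slanted h g d (toℕ k)) ∎))
    where
    open ≡-Reasoning
    up : ∀ (k : Fin m) t → Dec (Joins (toℕ k , h) (toℕ k + d , h + g) t)
    up k = Joins? (toℕ k , h) (toℕ k + d , h + g)
    down : ∀ (k : Fin m) t → Dec (Joins (toℕ k + d , h) (toℕ k , h + g) t)
    down k = Joins? (toℕ k + d , h) (toℕ k , h + g)

    below-m : ∀ {x x′} → x′ ≡ x + d → x′ < 2 * r + 1 → x < m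
    below-m {x} refl lt = +-cancelˡ-< d x m (subst₂ _<_ (+-comm x d) (sym d+m≡) lt)

    hit : ∀ t → low t ≡ h → gap t ≡ g → ∃ λ k → 1 ≤ ⟦ up k t ⟧ + ⟦ down k t ⟧
    hit t refl refl with endpoints t
    ... | x , x′ , J , x-x′ , x< , x′< with extremes x x′
    ... | inj₁ (e , e′) = fromℕ< x<m ,
          ≤-trans (≤-reflexive (sym (⟦⟧-true (up (fromℕ< x<m) t)
            (subst₂ (λ u v → Joins (u , h) (v , h + g) t) (sym k≡) (trans x′≡ (cong (_+ d) (sym k≡))) J)))) (m≤m+n _ _)
        where
        x′≡ : x′ ≡ x + d
        x′≡ = trans e′ (cong₂ _+_ (sym e) (trans x-x′ (dx t refl)))
        x<m = below-m x′≡ x′<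
        k≡ = Fin.toℕ-fromℕ< x<m
    ... | inj₂ (e′ , e) = fromℕ< x′<m ,
          ≤-trans (≤-reflexive (sym (⟦⟧-true (down (fromℕ< x′<m) t)
            (subst₂ (λ u v → Joins (u , h) (v , h + g) t) (trans x≡ (cong (_+ d) (sym k≡))) (sym k≡) J)))) (m≤n+m _ _)
        where
        x≡ : x ≡ x′ + d
        x≡ = trans e (cong₂ _+_ (sym e′) (trans x-x′ (dx t refl)))
        x′<m = below-m x≡ x<
        k≡ = Fin.toℕ-fromℕ< x′<m

    pointwise : ∀ t → ⟦ (low t ≟ h) ×-dec (gap t ≟ g) ⟧ ≤ sum {m} (λ k → ⟦ up k t ⟧ + ⟦ down k t ⟧)
    pointwise t = by-cases ((low t ≟ h) ×-dec (gap t ≟ g))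
      where
      by-cases : (d : Dec (low t ≡ h × gap t ≡ g)) → ⟦ d ⟧ ≤ sum {m} (λ k → ⟦ up k t ⟧ + ⟦ down k t ⟧)
      by-cases (no _) = z≤n
      by-cases (yes (e , e′)) with hit t e e′
      ... | k , h = ≤-trans h (term≤sum (λ k → ⟦ up k t ⟧ + ⟦ down k t ⟧) k)

  a-count : ∀ h → a h ≤ sum {suc r} (λ k → slanted h (suc r) r (toℕ k))
  a-count h = level-count h (suc r) r (suc r) (e r) dx
    where
    e : ∀ r → r + suc r ≡ 2 * r + 1
    e = solve-∀
    dx : ∀ t → gap t ≡ suc r → ∣ X t - X (csuc t) ∣ ≡ r
    dx t g with gap-cases t
    ... | inj₁ (e , _)  = e
    ... | inj₂ (_ , g′) = contradiction (trans (sym g) g′) 1+n≢n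

  b-count : ∀ h → b h ≤ sum {r} (λ k → slanted h r (suc r) (toℕ k))
  b-count h = level-count h r (suc r) r (e r) dx
    where
    e : ∀ r → suc r + r ≡ 2 * r + 1
    e = solve-∀
    dx : ∀ t → gap t ≡ r → ∣ X t - X (csuc t) ∣ ≡ suc r
    dx t g with gap-cases t
    ... | inj₁ (_ , g′) = contradiction (trans (sym g′) g) 1+n≢n
    ... | inj₂ (e , _)  = e

  level-counts : LevelCounts r n
  level-counts = record
    { G = G ; a = a ; b = b
    ; G-bottom = λ {x} x≤r x≤n → trans (sym (+-identityʳ (G x)))
        (trans (cong (G x +_) (sym (count-none (λ t → low t + gap t <? x)
          (λ t h → <⇒≱ h (≤-trans x≤r (≤-trans (r≤gap t) (m≤n+m _ _)))))))
          (double-count x≤n))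
    ; G-suc = ab-count
    ; G-reflect = λ x h → trans (+-assoc (G (x + suc r)) (G x) (b x))
        (trans (cong (G (x + suc r) +_) (sym (high-count x))) (double-count h))
    ; a≤ = λ x → ≤-trans (a-count x) (≤-trans (sum-mono {suc r} (λ k → slanted≤2 x (suc r) r (toℕ k)))
        (≤-reflexive (trans (sum-const (suc r) 2) (e r))))
    ; b≤ = λ x → ≤-trans (b-count x) (≤-trans (sum-mono {r} (λ k → slanted≤2 x r (suc r) (toℕ k)))
        (≤-reflexive (trans (sum-const r 2) (*-comm r 2))))
    ; G-top = λ {x} n≤ → count-all (λ t → low t <? x) (λ t →
        +-cancelʳ-< r _ x (≤-trans (≤-<-trans (+-monoʳ-≤ (low t) (r≤gap t)) (high< t)) n≤))
    }
    where
    e : ∀ r → suc r * 2 ≡ 2 * r + 2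
    e = solve-∀

  colour : Fin N → ℕ
  colour t = (X t + Y t) % 2

  -- A move changes `X + Y` by an odd amount, since `r + (r + 1)` is odd.
  colour-alternates : ∀ t → colour t + colour (csuc t) ≡ 1
  colour-alternates t = odd-sum (X t + Y t) (X (csuc t) + Y (csuc t)) {proj₁ (sums t)} (proj₂ (sums t))
    where
    sums : ∀ t → ∃ λ q → X t + Y t + (X (csuc t) + Y (csuc t)) ≡ 1 + q * 2
    sums t with extremes (X t) (X (csuc t)) | extremes (Y t) (Y (csuc t))
    ... | p | q = r + X t ⊓ X (csuc t) + low t , trans (f (X t) (Y t) _ _)
        (trans (cong₂ _+_ (total p) (total q))
          (trans (g (X t ⊓ X (csuc t)) ∣ X t - X (csuc t) ∣ (low t) (gap t))
          (trans (cong (λ z → z + (X t ⊓ X (csuc t) + low t) * 2) (both (gap-cases t))) (k r (X t ⊓ X (csuc t)) (low t)))))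
      where
      total : ∀ {x x′} → (x ≡ x ⊓ x′ × x′ ≡ x ⊓ x′ + ∣ x - x′ ∣) ⊎ (x′ ≡ x ⊓ x′ × x ≡ x ⊓ x′ + ∣ x - x′ ∣) →
              x + x′ ≡ x ⊓ x′ + x ⊓ x′ + ∣ x - x′ ∣
      total {x} {x′} (inj₁ (e , e′)) = trans (cong₂ _+_ e e′) (sym (+-assoc (x ⊓ x′) (x ⊓ x′) _))
      total {x} {x′} (inj₂ (e , e′)) = trans (+-comm x x′) (trans (cong₂ _+_ e e′) (sym (+-assoc (x ⊓ x′) (x ⊓ x′) _)))
      both : (∣ X t - X (csuc t) ∣ ≡ r × gap t ≡ suc r) ⊎ (∣ X t - X (csuc t) ∣ ≡ suc r × gap t ≡ r) →
             ∣ X t - X (csuc t) ∣ + gap t ≡ 1 + r * 2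
      both (inj₁ (e , e′)) = trans (cong₂ _+_ e e′) (l r)
        where l : ∀ r → r + suc r ≡ 1 + r * 2
              l = solve-∀
      both (inj₂ (e , e′)) = trans (cong₂ _+_ e e′) (l r)
        where l : ∀ r → suc r + r ≡ 1 + r * 2
              l = solve-∀
      f : ∀ x y x′ y′ → x + y + (x′ + y′) ≡ x + x′ + (y + y′)
      f = solve-∀
      g : ∀ m d l g → m + m + d + (l + l + g) ≡ d + g + (m + l) * 2
      g = solve-∀
      k : ∀ r m l → 1 + r * 2 + (m + l) * 2 ≡ 1 + (r + m + l) * 2
      k = solve-∀
    odd-sum : ∀ u v {q} → u + v ≡ 1 + q * 2 → u % 2 + v % 2 ≡ 1
    odd-sum u v {q} e = small (m%n<n u 2) (m%n<n v 2)
      (trans (sym (%-distribˡ-+ u v 2)) (trans (cong (_% 2) e) ([m+kn]%n≡m%n 1 q 2)))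
      where
      small : ∀ {x y} → x < 2 → y < 2 → (x + y) % 2 ≡ 1 → x + y ≡ 1
      small {0} {1} _ _ _ = refl
      small {1} {0} _ _ _ = refl
      small {suc (suc _)} (s≤s (s≤s ())) _ _
      small {0} {suc (suc _)} _ (s≤s (s≤s ())) _
      small {1} {suc (suc _)} _ (s≤s (s≤s ())) _

  size-even : ((2 * r + 1) * n) % 2 ≡ 0
  size-even = trans (cong (_% 2) N≡) (m*n%n≡0 (sum colour) 2)
    where
    N≡ : N ≡ sum colour * 2
    N≡ = begin
      N                                       ≡⟨ trans (sym (*-identityʳ N)) (sym (sum-const N 1)) ⟩
      sum {N} (λ _ → 1)                       ≡⟨ sum-cong-≗ {N} colour-alternates ⟨
      sum (λ t → colour t + colour (csuc t))  ≡⟨ ∑-distrib-+ colour (λ t → colour (csuc t)) ⟩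
      sum colour + sum (λ t → colour (csuc t)) ≡⟨ cong (sum colour +_) (sum-csuc colour) ⟩
      sum colour + sum colour                 ≡⟨ e (sum colour) ⟩
      sum colour * 2                          ∎
      where
      open ≡-Reasoning
      e : ∀ s → s + s ≡ s * 2
      e = solve-∀

  -- Closed walks inside the circuit

  Used : ℕ × ℕ → ℕ × ℕ → Set
  Used v w = ∃ (Joins v w)

  edge⇒Used : ∀ {v w} → 1 ≤ edge v w → Used v w
  edge⇒Used {v} {w} = count-witness (Joins? v w)

  -- At each vertex of the closed walk `f` the steps before and after are different edges, hence
  -- they are both circuit edges there. The circuit therefore never leaves the walk and cannot reach
  -- the avoided vertex.
  no-short-cycle : ∀ {k} (f : Fin (suc k) → ℕ × ℕ) → (∀ i → Used (f i) (f (csuc i))) →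
                   (∀ i → f i ≢ f (csuc (csuc i))) →
                   ∀ {x y} → x < 2 * r + 1 → y < n → (∀ i → f i ≢ (x , y)) → ⊥
  no-short-cycle {k} f used f≢ x< y< avoids = avoids (proj₁ everywhere) (At-functional (proj₂ everywhere) (proj₂ (At-exists x< y<)))
    where
    Visited : Fin N → Set
    Visited t = ∃ λ i → At (f i) t

    step : ∀ t → Visited t → Visited (csuc t)
    step t (i , p) with used (cpred i) | used i
    ... | t₁ , J₁ | t₂ , J₂ = follow (subst (λ z → Joins (f (cpred i)) (f z) t₁) (csuc-cpred i) J₁) J₂
      where
      follow : Joins (f (cpred i)) (f i) t₁ → Joins (f i) (f (csuc i)) t₂ → Visited (csuc t)
      follow (inj₂ (q , q′)) _ = cpred i , subst (λ z → At (f (cpred i)) (csuc z)) (At-injective q p) q′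
      follow _ (inj₁ (q , q′)) = csuc i , subst (λ z → At (f (csuc i)) (csuc z)) (At-injective q p) q′
      -- Both edges would enter `f i` in circuit order; they would then share one index and the walk
      -- would turn back.
      follow (inj₁ (q , q′)) (inj₂ (u , u′)) = contradiction
        (At-functional q (subst (At (f (csuc i))) (csuc-injective (At-injective u′ q′)) u))
        (subst (λ z → f (cpred i) ≢ f (csuc z)) (csuc-cpred i) (f≢ (cpred i)))

    start : ∃ Visited
    start with used Fin.zero
    ... | t , inj₁ (p , _) = t , Fin.zero , p
    ... | t , inj₂ (_ , p) = csuc t , Fin.zero , p

    everywhere : Visited (proj₁ (At-exists x< y<))
    everywhere = csuc-induction Visited step (proj₂ start) _

saturated : ∀ {k} (f : Fin k → ℕ) c → (∀ i → f i ≤ c) → k * c ≤ sum f → ∀ i → c ≤ f i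
saturated {suc k} f c f≤ h Fin.zero = +-cancelʳ-≤ (k * c) c (f Fin.zero)
  (≤-trans h (+-monoʳ-≤ (f Fin.zero) (≤-trans (sum-mono (λ i → f≤ (Fin.suc i))) (≤-reflexive (sum-const k c)))))
saturated {suc k} f c f≤ h (Fin.suc i) = saturated (λ j → f (Fin.suc j)) c (λ j → f≤ (Fin.suc j))
  (+-cancelˡ-≤ c (k * c) _ (≤-trans h (+-monoˡ-≤ _ (f≤ Fin.zero)))) i

unsaturated : ∀ {k} (f : Fin k → ℕ) → (∀ i → f i ≤ 1) → ¬ (∀ i → 1 ≤ f i) → sum f < k
unsaturated {k} f f≤ ¬all with sum f <? k
... | yes lt = lt
... | no ge  = contradiction (saturated f 1 f≤ (≤-trans (≤-reflexive (*-identityʳ k)) (≮⇒≥ ge))) ¬all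

∣-∣-solve : ∀ m x {d} → ∣ m - x ∣ ≡ d → x ≡ m + d ⊎ x + d ≡ m
∣-∣-solve m x refl with extremes m x
... | inj₁ (e , e′) = inj₁ (trans e′ (cong (_+ ∣ m - x ∣) (sym e)))
... | inj₂ (e , e′) = inj₂ (trans (cong (_+ ∣ m - x ∣) e) (sym e′))

-- The case `r = 4`: consequences of the counts

module Levels {n} (L : LevelCounts 4 n) (13≤n : 13 ≤ n) where
  open LevelCounts L

  G-initial : ∀ {x} → x ≤ 4 → G x ≡ 18 * x
  G-initial x≤4 = G-bottom x≤4 (≤-trans x≤4 (≤-trans (m≤m+n 4 9) 13≤n))

  full : ∀ h → G h + 18 ≤ G (suc h) → 10 ≤ a h × 8 ≤ b h
  full h le = aux (G h) (G (suc h)) (a h) (b h) (G-suc h) le (a≤ h) (b≤ h)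
    where
    aux : ∀ g g′ α β → g′ ≡ g + (α + β) → g + 18 ≤ g′ → α ≤ 10 → β ≤ 8 → 10 ≤ α × 8 ≤ β
    aux g g′ α β e h hα hβ = farkas _ _ (≤-reflexive e ⊕ h ⊕ hβ) (solve (g ∷ g′ ∷ α ∷ β ∷ []))
                           , farkas _ _ (≤-reflexive e ⊕ h ⊕ hα) (solve (g ∷ g′ ∷ α ∷ β ∷ []))

  full-initial : ∀ h → h < 4 → 10 ≤ a h × 8 ≤ b h
  full-initial h h<4 = full h (≤-reflexive (trans (cong (_+ 18) (G-initial (<⇒≤ h<4)))
    (trans (trans (+-comm _ 18) (sym (*-suc 18 h))) (sym (G-initial h<4)))))

  G8 : G 8 ≡ 82
  G8 = aux (b 3) (G-reflect 3 (≤-trans (m≤m+n 8 5) 13≤n)) (G-initial {3} (m≤m+n 3 1)) (≤-antisym (b≤ 3) (proj₂ (full-initial 3 ≤-refl)))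
    where
    aux : ∀ β {g g′} → g′ + g + β ≡ 144 → g ≡ 54 → β ≡ 8 → g′ ≡ 82
    aux β {g} {g′} e refl refl = +-cancelʳ-≡ 62 g′ 82 (trans (sym (+-assoc g′ 54 8)) e)

-- Six reflections of distance 5 lead from height 8 to 38 = 42 - 4. Their alternating sum is `b 8 +
-- b 18 + b 28 = 26 + b 13 + b 23 + b 33`, but the left side is at most 24.
n≢42 : LevelCounts 4 42 → ⊥
n≢42 L = aux (G 13) (G 18) (G 23) (G 28) (G 33) (G 38) (b 13) (b 23) (b 33)
    (G-reflect 8 (m≤m+n 13 29)) (G-reflect 13 (m≤m+n 18 24)) (G-reflect 18 (m≤m+n 23 19))
    (G-reflect 23 (m≤m+n 28 14)) (G-reflect 28 (m≤m+n 33 9)) (G-reflect 33 (m≤m+n 38 4))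
    G8 (G-top {38} ≤-refl) (b≤ 8) (b≤ 18) (b≤ 28)
  where
  open LevelCounts L
  open Levels L (m≤m+n 13 29)
  aux : ∀ g₁₃ g₁₈ g₂₃ g₂₈ g₃₃ g₃₈ b₁₃ b₂₃ b₃₃ {g₈ b₈ b₁₈ b₂₈} →
        g₁₃ + g₈ + b₈ ≡ 234 → g₁₈ + g₁₃ + b₁₃ ≡ 324 → g₂₃ + g₁₈ + b₁₈ ≡ 414 →
        g₂₈ + g₂₃ + b₂₃ ≡ 504 → g₃₃ + g₂₈ + b₂₈ ≡ 594 → g₃₈ + g₃₃ + b₃₃ ≡ 684 →
        g₈ ≡ 82 → g₃₈ ≡ 378 → b₈ ≤ 8 → b₁₈ ≤ 8 → b₂₈ ≤ 8 → ⊥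
  aux g₁₃ g₁₈ g₂₃ g₂₈ g₃₃ g₃₈ b₁₃ b₂₃ b₃₃ {_} {b₈} {b₁₈} {b₂₈} e₁ e₂ e₃ e₄ e₅ e₆ refl refl h₁ h₂ h₃ =
    <⇒≱ {1} {2} ≤-refl (farkas 2 1
      (≡⇒≥ e₁ ⊕ ≤-reflexive e₂ ⊕ ≡⇒≥ e₃ ⊕ ≤-reflexive e₄ ⊕ ≡⇒≥ e₅ ⊕ ≤-reflexive e₆ ⊕ h₁ ⊕ h₂ ⊕ h₃
        ⊕ z≤n {b₁₃} ⊕ z≤n {b₂₃} ⊕ z≤n {b₃₃} ⊕ z≤n {1})
      (solve (g₁₃ ∷ g₁₈ ∷ g₂₃ ∷ g₂₈ ∷ g₃₃ ∷ b₁₃ ∷ b₂₃ ∷ b₃₃ ∷ b₈ ∷ b₁₈ ∷ b₂₈ ∷ [])))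

-- Four reflections of distance 5 and two of distance 4 lead from 8 to 36. Their alternating sum is
-- `b 8 + b 18 + a 31 = 26 + b 13 + b 23 + a 27`, where `b 18 + a 31 ≤ 18`.
b8-of-40 : (L : LevelCounts 4 40) → 8 ≤ LevelCounts.b L 8
b8-of-40 L = aux (G 13) (G 18) (G 23) (G 28) (G 32) (a 27) (b 8) (b 13) (b 23)
    (G-reflect 8 (m≤m+n 13 27)) (G-reflect 13 (m≤m+n 18 22)) (G-reflect 18 (m≤m+n 23 17))
    (G-reflect 23 (m≤m+n 28 12)) (G-reflect′ L 27 (m≤m+n 32 8)) (G-reflect′ L 31 (m≤m+n 36 4))
    G8 (G-top {36} ≤-refl) (b≤ 18) (a≤ 31)
  where
  open LevelCounts L
  open Levels L (m≤m+n 13 27)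
  aux : ∀ g₁₃ g₁₈ g₂₃ g₂₈ g₃₂ a₂₇ b₈ b₁₃ b₂₃ {g₈ g₃₆ b₁₈ a₃₁} →
        g₁₃ + g₈ + b₈ ≡ 234 → g₁₈ + g₁₃ + b₁₃ ≡ 324 → g₂₃ + g₁₈ + b₁₈ ≡ 414 →
        g₂₈ + g₂₃ + b₂₃ ≡ 504 → g₃₂ + g₂₈ ≡ 576 + a₂₇ → g₃₆ + g₃₂ ≡ 648 + a₃₁ →
        g₈ ≡ 82 → g₃₆ ≡ 360 → b₁₈ ≤ 8 → a₃₁ ≤ 10 → 8 ≤ b₈
  aux g₁₃ g₁₈ g₂₃ g₂₈ g₃₂ a₂₇ b₈ b₁₃ b₂₃ {b₁₈ = b₁₈} {a₃₁} e₁ e₂ e₃ e₄ e₅ e₆ refl refl h₁ h₂ =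
    farkas _ _
      (≡⇒≥ e₁ ⊕ ≤-reflexive e₂ ⊕ ≡⇒≥ e₃ ⊕ ≤-reflexive e₄ ⊕ ≡⇒≥ e₅ ⊕ ≤-reflexive e₆ ⊕ h₁ ⊕ h₂
        ⊕ z≤n {b₁₃} ⊕ z≤n {b₂₃} ⊕ z≤n {a₂₇})
      (solve (g₁₃ ∷ g₁₈ ∷ g₂₃ ∷ g₂₈ ∷ g₃₂ ∷ a₂₇ ∷ b₈ ∷ b₁₃ ∷ b₂₃ ∷ b₁₈ ∷ a₃₁ ∷ []))

module _ (L : LevelCounts 4 38) where
  open LevelCounts L
  open Levels L (m≤m+n 13 25)

  -- The distances 5, 4, 5, 4, 4, 4 lead from 8 to 34, with alternating sum `b 8 + a 12 + b 17 + a
  -- 21 + a 29 = 44 + a 25`. As the four capacities add up to 36, at most two edges are missing on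
  -- these levels.
  levels-of-38 : 34 ≤ b 8 + a 12 + b 17 + a 21
  levels-of-38 = aux (G 13) (G 17) (G 22) (G 26) (G 30) (b 8) (a 12) (b 17) (a 21) (a 25)
      (G-reflect 8 (m≤m+n 13 25)) (G-reflect′ L 12 (m≤m+n 17 21)) (G-reflect 17 (m≤m+n 22 16))
      (G-reflect′ L 21 (m≤m+n 26 12)) (G-reflect′ L 25 (m≤m+n 30 8)) (G-reflect′ L 29 (m≤m+n 34 4))
      G8 (G-top {34} ≤-refl) (a≤ 29)
    where
    aux : ∀ g₁₃ g₁₇ g₂₂ g₂₆ g₃₀ b₈ a₁₂ b₁₇ a₂₁ a₂₅ {g₈ g₃₄ a₂₉} →
          g₁₃ + g₈ + b₈ ≡ 234 → g₁₇ + g₁₃ ≡ 306 + a₁₂ → g₂₂ + g₁₇ + b₁₇ ≡ 396 →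
          g₂₆ + g₂₂ ≡ 468 + a₂₁ → g₃₀ + g₂₆ ≡ 540 + a₂₅ → g₃₄ + g₃₀ ≡ 612 + a₂₉ →
          g₈ ≡ 82 → g₃₄ ≡ 342 → a₂₉ ≤ 10 → 34 ≤ b₈ + a₁₂ + b₁₇ + a₂₁
    aux g₁₃ g₁₇ g₂₂ g₂₆ g₃₀ b₈ a₁₂ b₁₇ a₂₁ a₂₅ {a₂₉ = a₂₉} e₁ e₂ e₃ e₄ e₅ e₆ refl refl h =
      farkas _ _
        (≡⇒≥ e₁ ⊕ ≤-reflexive e₂ ⊕ ≡⇒≥ e₃ ⊕ ≤-reflexive e₄ ⊕ ≡⇒≥ e₅ ⊕ ≤-reflexive e₆ ⊕ h ⊕ z≤n {a₂₅})
        (solve (g₁₃ ∷ g₁₇ ∷ g₂₂ ∷ g₂₆ ∷ g₃₀ ∷ b₈ ∷ a₁₂ ∷ b₁₇ ∷ a₂₁ ∷ a₂₅ ∷ a₂₉ ∷ []))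

  -- Three steps down from the top, the band has shrunk to the single row 22 = 38 - 3 * 5 - 1, with
  -- all edges going up.
  full-22 : 10 ≤ a 22 × 8 ≤ b 22
  full-22 = full 22 (Bands.top-band L 3 22 1 refl refl (m≤m+n 3 19))

-- The case `r = 4`: forced edges and closed 18-cycles

module Circuit₄ {n : ℕ} (H : LeaperHamiltonian 4 5 9 n) (13≤n : 13 ≤ n) where
  open HamiltonianCircuit H
  open Circuit {4} {n} H
  open Levels level-counts 13≤n

  Used-sym : ∀ {v w} → Used v w → Used w v
  Used-sym (t , J) = t , swap J

  -- Two of the three edges agree in orientation at `v`, and an index has only one successor and one
  -- predecessor.
  degree≤2 : ∀ {v w₁ w₂ w₃} → Used v w₁ → Used v w₂ → Used v w₃ → w₁ ≢ w₂ → w₁ ≢ w₃ → w₂ ≢ w₃ → ⊥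
  degree≤2 (_ , inj₁ (p , q)) (_ , inj₁ (p′ , q′)) _ ne _ _ = ne (At-functional q (subst (At _ ∘ csuc) (At-injective p′ p) q′))
  degree≤2 (_ , inj₁ (p , q)) _ (_ , inj₁ (p′ , q′)) _ ne _ = ne (At-functional q (subst (At _ ∘ csuc) (At-injective p′ p) q′))
  degree≤2 _ (_ , inj₁ (p , q)) (_ , inj₁ (p′ , q′)) _ _ ne = ne (At-functional q (subst (At _ ∘ csuc) (At-injective p′ p) q′))
  degree≤2 (_ , inj₂ (p , q)) (_ , inj₂ (p′ , q′)) _ ne _ _ = ne (At-functional p (subst (At _) (csuc-injective (At-injective q′ q)) p′))
  degree≤2 (_ , inj₂ (p , q)) _ (_ , inj₂ (p′ , q′)) _ ne _ = ne (At-functional p (subst (At _) (csuc-injective (At-injective q′ q)) p′))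
  degree≤2 _ (_ , inj₂ (p , q)) (_ , inj₂ (p′ , q′)) _ _ ne = ne (At-functional p (subst (At _) (csuc-injective (At-injective q′ q)) p′))

  Offset : ℕ × ℕ → ℕ × ℕ → Set
  Offset (x , y) (x′ , y′) = (∣ x - x′ ∣ ≡ 4 × ∣ y - y′ ∣ ≡ 5) ⊎ (∣ x - x′ ∣ ≡ 5 × ∣ y - y′ ∣ ≡ 4)

  -- The circuit uses two different neighbours of `(x , y)`; without `p` only `q` and `s` remain.
  forced-third : ∀ {x y p q s} → x < 9 → y < n →
                 (∀ {w} → proj₁ w < 9 → Offset (x , y) w → w ≡ p ⊎ w ≡ q ⊎ w ≡ s) →
                 ¬ Used (x , y) p → Used (x , y) s
  forced-third {x} {y} {p} {q} {s} x< y< only ¬p with At-exists x< y<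
  ... | t , refl , refl = choose
      (only {X (csuc t) , Y (csuc t)} (X< (csuc t)) (adj t))
      (only {X t′ , Y t′} (X< t′) back)
    where
    t′ = cpred t
    back : Offset (X t , Y t) (X t′ , Y t′)
    back with subst (λ z → Offset (X t′ , Y t′) (X z , Y z)) (csuc-cpred t) (adj t′)
    ... | inj₁ (e , e′) = inj₁ (trans (∣-∣-comm (X t) (X t′)) e , trans (∣-∣-comm (Y t) (Y t′)) e′)
    ... | inj₂ (e , e′) = inj₂ (trans (∣-∣-comm (X t) (X t′)) e , trans (∣-∣-comm (Y t) (Y t′)) e′)
    next-used : ∀ {w} → (X (csuc t) , Y (csuc t)) ≡ w → Used (X t , Y t) w
    next-used refl = t , inj₁ ((refl , refl) , (refl , refl))
    prev-used : ∀ {w} → (X t′ , Y t′) ≡ w → Used (X t , Y t) w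
    prev-used refl = t′ , inj₂ ((refl , refl) , (cong X (csuc-cpred t) , cong Y (csuc-cpred t)))
    different : (X (csuc t) , Y (csuc t)) ≢ (X t′ , Y t′)
    different e = csuc²-≢ atLeast3 t (trans (cong csuc (At-injective {X t′ , Y t′}
      (cong proj₁ e , cong proj₂ e) (refl , refl))) (csuc-cpred t))
    choose : let w = (X (csuc t) , Y (csuc t)); w′ = (X t′ , Y t′) in
             w ≡ p ⊎ w ≡ q ⊎ w ≡ s → w′ ≡ p ⊎ w′ ≡ q ⊎ w′ ≡ s → Used (X t , Y t) s
    choose (inj₁ e) _                       = contradiction (next-used e) ¬p
    choose _ (inj₁ e)                       = contradiction (prev-used e) ¬p
    choose (inj₂ (inj₂ e)) _                = next-used e
    choose _ (inj₂ (inj₂ e))                = prev-used e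
    choose (inj₂ (inj₁ e)) (inj₂ (inj₁ e′)) = contradiction (trans e (sym e′)) different

  both-used : ∀ h g d k → 2 ≤ slanted h g d k → Used (k , h) (k + d , h + g) × Used (k + d , h) (k , h + g)
  both-used h g d k le =
      edge⇒Used (+-cancelʳ-≤ 1 1 _ (≤-trans le (+-monoʳ-≤ (edge (k , h) (k + d , h + g)) (edge≤1 _ _))))
    , edge⇒Used (+-cancelˡ-≤ 1 1 _ (≤-trans le (+-monoˡ-≤ (edge (k + d , h) (k , h + g)) (edge≤1 _ _))))

  full-a : ∀ {h} → 10 ≤ a h → (k : Fin 5) → Used (toℕ k , h) (toℕ k + 4 , h + 5) × Used (toℕ k + 4 , h) (toℕ k , h + 5)
  full-a {h} le k = both-used h 5 4 (toℕ k)
    (saturated {5} (λ k → slanted h 5 4 (toℕ k)) 2 (λ k → slanted≤2 h 5 4 (toℕ k)) (≤-trans le (a-count h)) k)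

  full-b : ∀ {h} → 8 ≤ b h → (k : Fin 4) → Used (toℕ k , h) (toℕ k + 5 , h + 4) × Used (toℕ k + 5 , h) (toℕ k , h + 4)
  full-b {h} le k = both-used h 4 5 (toℕ k)
    (saturated {4} (λ k → slanted h 4 5 (toℕ k)) 2 (λ k → slanted≤2 h 4 5 (toℕ k)) (≤-trans le (b-count h)) k)

  a↗ : ∀ h (k : Fin 5) {h<4 : True (h <? 4)} → Used (toℕ k , h) (toℕ k + 4 , h + 5)
  a↗ h k {h<4} = proj₁ (full-a (proj₁ (full-initial h (toWitness h<4))) k)

  a↖ : ∀ h (k : Fin 5) {h<4 : True (h <? 4)} → Used (toℕ k + 4 , h) (toℕ k , h + 5)
  a↖ h k {h<4} = proj₂ (full-a (proj₁ (full-initial h (toWitness h<4))) k)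

  b↗ : ∀ h (k : Fin 4) {h<4 : True (h <? 4)} → Used (toℕ k , h) (toℕ k + 5 , h + 4)
  b↗ h k {h<4} = proj₁ (full-b (proj₂ (full-initial h (toWitness h<4))) k)

  b↖ : ∀ h (k : Fin 4) {h<4 : True (h <? 4)} → Used (toℕ k + 5 , h) (toℕ k , h + 4)
  b↖ h k {h<4} = proj₂ (full-b (proj₂ (full-initial h (toWitness h<4))) k)

  infixr 5 _∷′_
  _∷′_ : ∀ {k} {P : Fin (suc k) → Set} → P Fin.zero → (∀ i → P (Fin.suc i)) → ∀ i → P i
  (p ∷′ ps) Fin.zero    = p
  (p ∷′ ps) (Fin.suc i) = ps i

  []′ : ∀ {P : Fin 0 → Set} (i : Fin 0) → P i
  []′ ()

  -- The alternating cycles of the board of width 2 r + 1 = 9 have length 4 r + 2 = 18.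
  Closed : ∀ {k} → Vec (ℕ × ℕ) (suc k) → Set
  Closed v = ∀ i → Used (lookup v i) (lookup v (csuc i))

  not-closed : (v : Vec (ℕ × ℕ) 18) →
    {_ : True (Fin.all? (λ i → ¬? (≡-dec _≟_ _≟_ (lookup v i) (lookup v (csuc (csuc i))))))} →
    {_ : True (Fin.all? (λ i → ¬? (≡-dec _≟_ _≟_ (lookup v i) (0 , 0))))} →
    ¬ Closed v
  not-closed v {p} {q} closed = no-short-cycle (lookup v) closed (toWitness p)
    (s≤s z≤n) (≤-trans (s≤s z≤n) 13≤n) (toWitness q)

  -- The other sixteen edges start at heights 0 to 3 and are forced by `full-initial`; the two given
  -- ones close the cycle at `(4 , 9)`.
  corner-cycle : ¬ (Used (0 , 4) (4 , 9) × Used (8 , 4) (4 , 9))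
  corner-cycle (left , right) = not-closed
    (Vec.fromList ((0 , 4) ∷ (5 , 0) ∷ (1 , 5) ∷ (6 , 1) ∷ (2 , 6) ∷ (7 , 2) ∷ (3 , 7) ∷ (8 , 3) ∷ (4 , 8) ∷
     (0 , 3) ∷ (5 , 7) ∷ (1 , 2) ∷ (6 , 6) ∷ (2 , 1) ∷ (7 , 5) ∷ (3 , 0) ∷ (8 , 4) ∷ (4 , 9) ∷ []))
    (Used-sym (b↖ 0 (# 0)) ∷′ a↖ 0 (# 1) ∷′ Used-sym (b↖ 1 (# 1)) ∷′ a↖ 1 (# 2) ∷′ Used-sym (b↖ 2 (# 2)) ∷′ a↖ 2 (# 3) ∷′
     Used-sym (b↖ 3 (# 3)) ∷′ a↖ 3 (# 4) ∷′ Used-sym (a↗ 3 (# 0)) ∷′ b↗ 3 (# 0) ∷′ Used-sym (a↗ 2 (# 1)) ∷′ b↗ 2 (# 1) ∷′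
     Used-sym (a↗ 1 (# 2)) ∷′ b↗ 1 (# 2) ∷′ Used-sym (a↗ 0 (# 3)) ∷′ b↗ 0 (# 3) ∷′ right ∷′ Used-sym left ∷′ []′)

  -- (5 , 8) is saturated by (1 , 3) and (0 , 12), so (0 , 4) loses one of its three neighbours.
  left-corner : Used (5 , 8) (0 , 12) → Used (0 , 4) (4 , 9)
  left-corner u = forced-third {q = 5 , 0} (m≤m+n 1 8) (≤-trans (m≤m+n 5 8) 13≤n) neighbours
    (λ v → degree≤2 (Used-sym v) (Used-sym (a↗ 3 (# 1))) u (λ ()) (λ ()) (λ ()))
    where
    neighbours : ∀ {w} → proj₁ w < 9 → Offset (0 , 4) w → w ≡ (5 , 8) ⊎ w ≡ (5 , 0) ⊎ w ≡ (4 , 9)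
    neighbours {x , y} _ (inj₁ (e , e′)) with ∣-∣-solve 0 x e | ∣-∣-solve 4 y e′
    ... | inj₁ refl | inj₁ refl = inj₂ (inj₂ refl)
    ... | inj₁ refl | inj₂ eq   = contradiction (m+n≤o⇒n≤o y (≤-reflexive eq)) λ { (s≤s (s≤s (s≤s (s≤s ())))) }
    ... | inj₂ eq   | _         = contradiction (m+n≤o⇒n≤o x (≤-reflexive eq)) λ ()
    neighbours {x , y} _ (inj₂ (e , e′)) with ∣-∣-solve 0 x e | ∣-∣-solve 4 y e′
    ... | inj₁ refl | inj₁ refl = inj₁ refl
    ... | inj₁ refl | inj₂ eq   = inj₂ (inj₁ (cong (5 ,_) (+-cancelʳ-≡ 4 y 0 eq)))
    ... | inj₂ eq   | _         = contradiction (m+n≤o⇒n≤o x (≤-reflexive eq)) λ ()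

  -- Mirror image of `left-corner` under `x ↦ 8 - x`.
  right-corner : Used (3 , 8) (8 , 12) → Used (8 , 4) (4 , 9)
  right-corner u = forced-third {q = 3 , 0} ≤-refl (≤-trans (m≤m+n 5 8) 13≤n) neighbours
    (λ v → degree≤2 (Used-sym v) (Used-sym (a↖ 3 (# 3))) u (λ ()) (λ ()) (λ ()))
    where
    neighbours : ∀ {w} → proj₁ w < 9 → Offset (8 , 4) w → w ≡ (3 , 8) ⊎ w ≡ (3 , 0) ⊎ w ≡ (4 , 9)
    neighbours {x , y} x< (inj₁ (e , e′)) with ∣-∣-solve 8 x e | ∣-∣-solve 4 y e′
    ... | inj₁ refl | _         = contradiction x< (m+n≮m 9 3)
    ... | inj₂ eq   | inj₁ refl = inj₂ (inj₂ (cong (_, 9) (+-cancelʳ-≡ 4 x 4 eq)))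
    ... | inj₂ _    | inj₂ eq   = contradiction (m+n≤o⇒n≤o y (≤-reflexive eq)) λ { (s≤s (s≤s (s≤s (s≤s ())))) }
    neighbours {x , y} x< (inj₂ (e , e′)) with ∣-∣-solve 8 x e | ∣-∣-solve 4 y e′
    ... | inj₁ refl | _         = contradiction x< (m+n≮m 9 4)
    ... | inj₂ eq   | inj₁ refl = inj₁ (cong (_, 8) (+-cancelʳ-≡ 5 x 3 eq))
    ... | inj₂ eq   | inj₂ eq′  = inj₂ (inj₁ (cong₂ _,_ (+-cancelʳ-≡ 5 x 3 eq) (+-cancelʳ-≡ 4 y 0 eq′)))

  edges≤ : ∀ {k} (es : Vec ((ℕ × ℕ) × (ℕ × ℕ)) k) →
           ¬ (∀ i → Used (proj₁ (lookup es i)) (proj₂ (lookup es i))) →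
           sum (λ i → edge (proj₁ (lookup es i)) (proj₂ (lookup es i))) < k
  edges≤ es ¬all = unsaturated _ (λ i → edge≤1 _ _) (λ h → ¬all (λ i → edge⇒Used (h i)))

  corner≤1 : edge (5 , 8) (0 , 12) + (edge (3 , 8) (8 , 12) + 0) ≤ 1
  corner≤1 = ≤-pred (edges≤ (Vec.fromList (((5 , 8) , (0 , 12)) ∷ ((3 , 8) , (8 , 12)) ∷ []))
    (λ u → corner-cycle (left-corner (u (# 0)) , right-corner (u (# 1)))))

  -- The 3 covers the pair in `corner≤1` and two further single edges. The named edges are grouped
  -- by their membership in `inner-edges` and `outer-edges`, as in the next three splits.
  b8-split : b 8 ≤ (edge (2 , 8) (7 , 12) + edge (6 , 8) (1 , 12)) + (edge (1 , 8) (6 , 12) + edge (7 , 8) (2 , 12)) + 3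
  b8-split = aux (edge (0 , 8) (5 , 12)) (edge (5 , 8) (0 , 12)) (edge (1 , 8) (6 , 12)) (edge (6 , 8) (1 , 12))
                 (edge (2 , 8) (7 , 12)) (edge (7 , 8) (2 , 12)) (edge (3 , 8) (8 , 12)) (edge (8 , 8) (3 , 12)) (b 8)
                 (b-count 8) corner≤1 (edge≤1 _ _) (edge≤1 _ _)
    where
    aux : ∀ u₀ d₀ u₁ d₁ u₂ d₂ u₃ d₃ x → x ≤ u₀ + d₀ + (u₁ + d₁ + (u₂ + d₂ + (u₃ + d₃ + 0))) →
          d₀ + (u₃ + 0) ≤ 1 → u₀ ≤ 1 → d₃ ≤ 1 → x ≤ (u₂ + d₁) + (u₁ + d₂) + 3
    aux u₀ d₀ u₁ d₁ u₂ d₂ u₃ d₃ x h h₁ h₂ h₃ = farkas _ _ (h ⊕ h₁ ⊕ h₂ ⊕ h₃)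
      (solve (u₀ ∷ d₀ ∷ u₁ ∷ d₁ ∷ u₂ ∷ d₂ ∷ u₃ ∷ d₃ ∷ x ∷ []))

  b8≤7 : b 8 ≤ 7
  b8≤7 = ≤-trans b8-split (+-monoˡ-≤ 3 (+-mono-≤ (+-mono-≤ (edge≤1 (2 , 8) (7 , 12)) (edge≤1 (6 , 8) (1 , 12)))
                                                 (+-mono-≤ (edge≤1 (1 , 8) (6 , 12)) (edge≤1 (7 , 8) (2 , 12)))))

  a12-split : a 12 ≤ (edge (7 , 12) (3 , 17) + edge (1 , 12) (5 , 17)) + (edge (6 , 12) (2 , 17) + edge (2 , 12) (6 , 17)) + 6
  a12-split = aux (edge (0 , 12) (4 , 17)) (edge (4 , 12) (0 , 17)) (edge (1 , 12) (5 , 17)) (edge (5 , 12) (1 , 17))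
                  (edge (2 , 12) (6 , 17)) (edge (6 , 12) (2 , 17)) (edge (3 , 12) (7 , 17)) (edge (7 , 12) (3 , 17))
                  (edge (4 , 12) (8 , 17)) (edge (8 , 12) (4 , 17)) (a 12)
                  (a-count 12) (edge≤1 _ _) (edge≤1 _ _) (edge≤1 _ _) (edge≤1 _ _) (edge≤1 _ _) (edge≤1 _ _)
    where
    aux : ∀ u₀ d₀ u₁ d₁ u₂ d₂ u₃ d₃ u₄ d₄ x → x ≤ u₀ + d₀ + (u₁ + d₁ + (u₂ + d₂ + (u₃ + d₃ + (u₄ + d₄ + 0)))) →
          u₀ ≤ 1 → d₀ ≤ 1 → d₁ ≤ 1 → u₃ ≤ 1 → u₄ ≤ 1 → d₄ ≤ 1 → x ≤ (d₃ + u₁) + (d₂ + u₂) + 6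
    aux u₀ d₀ u₁ d₁ u₂ d₂ u₃ d₃ u₄ d₄ x h h₁ h₂ h₃ h₄ h₅ h₆ = farkas _ _ (h ⊕ h₁ ⊕ h₂ ⊕ h₃ ⊕ h₄ ⊕ h₅ ⊕ h₆)
      (solve (u₀ ∷ d₀ ∷ u₁ ∷ d₁ ∷ u₂ ∷ d₂ ∷ u₃ ∷ d₃ ∷ u₄ ∷ d₄ ∷ x ∷ []))

  b17-split : b 17 ≤ (edge (3 , 17) (8 , 21) + edge (5 , 17) (0 , 21)) + (edge (2 , 17) (7 , 21) + edge (6 , 17) (1 , 21)) + 4
  b17-split = aux (edge (0 , 17) (5 , 21)) (edge (5 , 17) (0 , 21)) (edge (1 , 17) (6 , 21)) (edge (6 , 17) (1 , 21))
                  (edge (2 , 17) (7 , 21)) (edge (7 , 17) (2 , 21)) (edge (3 , 17) (8 , 21)) (edge (8 , 17) (3 , 21)) (b 17)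
                  (b-count 17) (edge≤1 _ _) (edge≤1 _ _) (edge≤1 _ _) (edge≤1 _ _)
    where
    aux : ∀ u₀ d₀ u₁ d₁ u₂ d₂ u₃ d₃ x → x ≤ u₀ + d₀ + (u₁ + d₁ + (u₂ + d₂ + (u₃ + d₃ + 0))) →
          u₀ ≤ 1 → u₁ ≤ 1 → d₂ ≤ 1 → d₃ ≤ 1 → x ≤ (u₃ + d₀) + (u₂ + d₁) + 4
    aux u₀ d₀ u₁ d₁ u₂ d₂ u₃ d₃ x h h₁ h₂ h₃ h₄ = farkas _ _ (h ⊕ h₁ ⊕ h₂ ⊕ h₃ ⊕ h₄)
      (solve (u₀ ∷ d₀ ∷ u₁ ∷ d₁ ∷ u₂ ∷ d₂ ∷ u₃ ∷ d₃ ∷ x ∷ []))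

  a21-split : a 21 ≤ (edge (8 , 21) (4 , 26) + edge (0 , 21) (4 , 26)) + (edge (7 , 21) (3 , 26) + edge (1 , 21) (5 , 26)) + 6
  a21-split = aux (edge (0 , 21) (4 , 26)) (edge (4 , 21) (0 , 26)) (edge (1 , 21) (5 , 26)) (edge (5 , 21) (1 , 26))
                  (edge (2 , 21) (6 , 26)) (edge (6 , 21) (2 , 26)) (edge (3 , 21) (7 , 26)) (edge (7 , 21) (3 , 26))
                  (edge (4 , 21) (8 , 26)) (edge (8 , 21) (4 , 26)) (a 21)
                  (a-count 21) (edge≤1 _ _) (edge≤1 _ _) (edge≤1 _ _) (edge≤1 _ _) (edge≤1 _ _) (edge≤1 _ _)
    where
    aux : ∀ u₀ d₀ u₁ d₁ u₂ d₂ u₃ d₃ u₄ d₄ x → x ≤ u₀ + d₀ + (u₁ + d₁ + (u₂ + d₂ + (u₃ + d₃ + (u₄ + d₄ + 0)))) →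
          d₀ ≤ 1 → d₁ ≤ 1 → u₂ ≤ 1 → d₂ ≤ 1 → u₃ ≤ 1 → u₄ ≤ 1 → x ≤ (d₄ + u₀) + (d₃ + u₁) + 6
    aux u₀ d₀ u₁ d₁ u₂ d₂ u₃ d₃ u₄ d₄ x h h₁ h₂ h₃ h₄ h₅ h₆ = farkas _ _ (h ⊕ h₁ ⊕ h₂ ⊕ h₃ ⊕ h₄ ⊕ h₅ ⊕ h₆)
      (solve (u₀ ∷ d₀ ∷ u₁ ∷ d₁ ∷ u₂ ∷ d₂ ∷ u₃ ∷ d₃ ∷ u₄ ∷ d₄ ∷ x ∷ []))

  inner-edges outer-edges : Vec ((ℕ × ℕ) × (ℕ × ℕ)) 8
  inner-edges = Vec.fromList (((2 , 8) , (7 , 12)) ∷ ((6 , 8) , (1 , 12)) ∷ ((7 , 12) , (3 , 17)) ∷ ((1 , 12) , (5 , 17)) ∷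
                ((3 , 17) , (8 , 21)) ∷ ((5 , 17) , (0 , 21)) ∷ ((8 , 21) , (4 , 26)) ∷ ((0 , 21) , (4 , 26)) ∷ [])
  outer-edges = Vec.fromList (((1 , 8) , (6 , 12)) ∷ ((7 , 8) , (2 , 12)) ∷ ((6 , 12) , (2 , 17)) ∷ ((2 , 12) , (6 , 17)) ∷
                ((2 , 17) , (7 , 21)) ∷ ((6 , 17) , (1 , 21)) ∷ ((7 , 21) , (3 , 26)) ∷ ((1 , 21) , (5 , 26)) ∷ [])

  -- The remaining ten edges start at heights 1 to 3, where all board edges going up are used.
  inner-cycle : ¬ (∀ i → Used (proj₁ (lookup inner-edges i)) (proj₂ (lookup inner-edges i)))
  inner-cycle u = not-closed
    (Vec.fromList ((4 , 1) ∷ (0 , 6) ∷ (5 , 2) ∷ (1 , 7) ∷ (6 , 3) ∷ (2 , 8) ∷ (7 , 12) ∷ (3 , 17) ∷ (8 , 21) ∷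
     (4 , 26) ∷ (0 , 21) ∷ (5 , 17) ∷ (1 , 12) ∷ (6 , 8) ∷ (2 , 3) ∷ (7 , 7) ∷ (3 , 2) ∷ (8 , 6) ∷ []))
    (a↖ 1 (# 0) ∷′ Used-sym (b↖ 2 (# 0)) ∷′ a↖ 2 (# 1) ∷′ Used-sym (b↖ 3 (# 1)) ∷′ a↖ 3 (# 2) ∷′ u (# 0) ∷′ u (# 2) ∷′ u (# 4) ∷′ u (# 6) ∷′
     Used-sym (u (# 7)) ∷′ Used-sym (u (# 5)) ∷′ Used-sym (u (# 3)) ∷′ Used-sym (u (# 1)) ∷′
     Used-sym (a↗ 3 (# 2)) ∷′ b↗ 3 (# 2) ∷′ Used-sym (a↗ 2 (# 3)) ∷′ b↗ 2 (# 3) ∷′ Used-sym (a↗ 1 (# 4)) ∷′ []′)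

  -- Six forced edges start at heights 2 and 3; four more, through the turning point `(4 , 27)`,
  -- come from the full row 22.
  outer-cycle : 10 ≤ a 22 → 8 ≤ b 22 → ¬ (∀ i → Used (proj₁ (lookup outer-edges i)) (proj₂ (lookup outer-edges i)))
  outer-cycle a22 b22 u = not-closed
    (Vec.fromList ((4 , 2) ∷ (0 , 7) ∷ (5 , 3) ∷ (1 , 8) ∷ (6 , 12) ∷ (2 , 17) ∷ (7 , 21) ∷ (3 , 26) ∷ (8 , 22) ∷
     (4 , 27) ∷ (0 , 22) ∷ (5 , 26) ∷ (1 , 21) ∷ (6 , 17) ∷ (2 , 12) ∷ (7 , 8) ∷ (3 , 3) ∷ (8 , 7) ∷ []))
    (a↖ 2 (# 0) ∷′ Used-sym (b↖ 3 (# 0)) ∷′ a↖ 3 (# 1) ∷′ u (# 0) ∷′ u (# 2) ∷′ u (# 4) ∷′ u (# 6) ∷′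
     Used-sym (proj₂ (full-b b22 (# 3))) ∷′ proj₂ (full-a a22 (# 4)) ∷′ Used-sym (proj₁ (full-a a22 (# 0))) ∷′ proj₁ (full-b b22 (# 0)) ∷′
     Used-sym (u (# 7)) ∷′ Used-sym (u (# 5)) ∷′ Used-sym (u (# 3)) ∷′ Used-sym (u (# 1)) ∷′
     Used-sym (a↗ 3 (# 3)) ∷′ b↗ 3 (# 3) ∷′ Used-sym (a↗ 2 (# 4)) ∷′ []′)

  -- Of the 36 board edges that start in these four levels, each of the disjoint sets
  -- inner-edges, outer-edges and the two edges of corner≤1 contains an unused one.
  levels≤33 : 10 ≤ a 22 → 8 ≤ b 22 → b 8 + a 12 + b 17 + a 21 ≤ 33
  levels≤33 a22 b22 = aux
      (edge (2 , 8) (7 , 12)) (edge (6 , 8) (1 , 12)) (edge (7 , 12) (3 , 17)) (edge (1 , 12) (5 , 17))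
      (edge (3 , 17) (8 , 21)) (edge (5 , 17) (0 , 21)) (edge (8 , 21) (4 , 26)) (edge (0 , 21) (4 , 26))
      (edge (1 , 8) (6 , 12)) (edge (7 , 8) (2 , 12)) (edge (6 , 12) (2 , 17)) (edge (2 , 12) (6 , 17))
      (edge (2 , 17) (7 , 21)) (edge (6 , 17) (1 , 21)) (edge (7 , 21) (3 , 26)) (edge (1 , 21) (5 , 26))
      (b 8) (a 12) (b 17) (a 21)
      b8-split a12-split b17-split a21-split (edges≤ inner-edges inner-cycle) (edges≤ outer-edges (outer-cycle a22 b22))
    where
    aux : ∀ i₁ i₂ i₃ i₄ i₅ i₆ i₇ i₈ o₁ o₂ o₃ o₄ o₅ o₆ o₇ o₈ x y z w →
          x ≤ (i₁ + i₂) + (o₁ + o₂) + 3 → y ≤ (i₃ + i₄) + (o₃ + o₄) + 6 →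
          z ≤ (i₅ + i₆) + (o₅ + o₆) + 4 → w ≤ (i₇ + i₈) + (o₇ + o₈) + 6 →
          i₁ + (i₂ + (i₃ + (i₄ + (i₅ + (i₆ + (i₇ + (i₈ + 0))))))) < 8 →
          o₁ + (o₂ + (o₃ + (o₄ + (o₅ + (o₆ + (o₇ + (o₈ + 0))))))) < 8 →
          x + y + z + w ≤ 33
    aux i₁ i₂ i₃ i₄ i₅ i₆ i₇ i₈ o₁ o₂ o₃ o₄ o₅ o₆ o₇ o₈ x y z w hx hy hz hw hi ho =
      farkas _ _ (hx ⊕ hy ⊕ hz ⊕ hw ⊕ hi ⊕ ho)
        (solve (i₁ ∷ i₂ ∷ i₃ ∷ i₄ ∷ i₅ ∷ i₆ ∷ i₇ ∷ i₈ ∷ o₁ ∷ o₂ ∷ o₃ ∷ o₄ ∷ o₅ ∷ o₆ ∷ o₇ ∷ o₈ ∷ x ∷ y ∷ z ∷ w ∷ []))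

-- The remaining heights for `r = 4` and the final bounds

odd-size : ∀ {n} → (9 * n) % 2 ≡ 1 → ¬ LeaperHamiltonian 4 5 9 n
odd-size {n} odd H = 0≢1+n (trans (sym (Circuit.size-even {4} {n} H)) odd)

bound₄ : ∀ k → k < 7 → ¬ LeaperHamiltonian 4 5 9 (37 + k)
bound₄ 0 _ = odd-size {37} refl
bound₄ 1 _ H = <⇒≱ (s≤s (levels≤33 (proj₁ (full-22 level-counts)) (proj₂ (full-22 level-counts)))) (levels-of-38 level-counts)
  where
  open Circuit {4} {38} H
  open Circuit₄ H (m≤m+n 13 25)
bound₄ 2 _ = odd-size {39} refl
bound₄ 3 _ H = <⇒≱ (s≤s b8≤7) (b8-of-40 level-counts)
  where
  open Circuit {4} {40} H
  open Circuit₄ H (m≤m+n 13 27)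
bound₄ 4 _ = odd-size {41} refl
bound₄ 5 _ H = n≢42 (Circuit.level-counts {4} {42} H)
bound₄ 6 _ = odd-size {43} refl
bound₄ (suc (suc (suc (suc (suc (suc (suc k))))))) k<7 _ = contradiction k<7 (m+n≮m 7 k)

2r²+r<n : ∀ {r n} → 0 < r → 0 < n → LeaperHamiltonian r (suc r) (2 * r + 1) n → 2 * (r * r) + r < n
2r²+r<n 0<r 0<n H = ≰⇒> (λ n≤ → no-level-counts 0<r 0<n n≤ (Circuit.level-counts H))

theorem3 : (r n : ℕ) → 3 < r → 0 < n →
    LeaperHamiltonian r (suc r) (2 * r + 1) n →
    (r % 2 ≡ 1 → r * r + 5 * r + 2 ≤ n) × (r % 2 ≡ 0 → r * r + 6 * r + 4 ≤ n)
theorem3 1 _ (s≤s ()) _ _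
theorem3 2 _ (s≤s (s≤s ())) _ _
theorem3 3 _ (s≤s (s≤s (s≤s ()))) _ _
-- Here `2 r² + r = 36` while the claim asks for 44, so the heights `37 + k` with `k < 7` are left
-- to `bound₄`.
theorem3 4 n 3<r 0<n H = (λ ()) , λ _ → ≮⇒≥ λ n<44 →
  bound₄ (n ∸ 37) (+-cancelˡ-< 37 _ 7 (subst (_< 44) (sym n≡) n<44)) (subst (LeaperHamiltonian 4 5 9) (sym n≡) H)
  where
  n≡ : 37 + (n ∸ 37) ≡ n
  n≡ = m+[n∸m]≡n (2r²+r<n (s≤s z≤n) 0<n H)
theorem3 (suc (suc (suc (suc (suc q))))) n 3<r 0<n H =
    (λ _ → ≤-trans (odd q) 2r²+r<n′) , λ even → ≤-trans (even-bound q even) 2r²+r<n′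
  where
  2r²+r<n′ : 2 * ((5 + q) * (5 + q)) + (5 + q) < n
  2r²+r<n′ = 2r²+r<n (s≤s z≤n) 0<n H
  odd : ∀ q → (5 + q) * (5 + q) + 5 * (5 + q) + 2 ≤ suc (2 * ((5 + q) * (5 + q)) + (5 + q))
  odd q = ≤-trans (m≤m+n _ (4 + 6 * q + q * q)) (≤-reflexive (solve (q ∷ [])))
  even-bound : ∀ q → (5 + q) % 2 ≡ 0 → (5 + q) * (5 + q) + 6 * (5 + q) + 4 ≤ suc (2 * ((5 + q) * (5 + q)) + (5 + q))
  -- At `r = 5` the inequality would read 59 ≤ 56, but 5 is odd and the parity hypothesis is absurd.
  -- From `r = 6 + q` on, the slack is `3 + 7 q + q²`.
  even-bound (suc q) _ = ≤-trans (m≤m+n _ (3 + 7 * q + q * q)) (≤-reflexive (solve (q ∷ [])))
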